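{- Let $\mathbb{F}$ be any field and $d\ge 2$. Let $\mathcal L_1,\dots,\mathcal L_d$ be finite sets of lines in $\mathbb{F}^d$, and let $\mathcal J$ be a set of points each of which is the intersection of exactly one line from each $\mathcal L_i$ ($i=1,\dots,d$), these $d$ lines not all lying in a common hyperplane. Then \[ |\mathcal J|\le \bigl(d!\,|\mathcal L_1|\cdots|\mathcal L_d|\bigr)^{1/(d-1)}. \] -}

module Defs where

open import Level using (Level; _⊔_) renaming (suc to lsuc)
open import Data.Nat using (ℕ; zero; suc)
open import Data.Fin using (Fin; zero; suc)
open import Data.Product using (Σ; ∃; _×_; _,_)
open import Data.List using (List; length; lookup)
open import Data.List.Relation.Unary.AllPairs using (AllPairs)
open import Relation.Nullary using (¬_)
open import Relation.Binary.PropositionalEquality using (_≡_)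
open import Function.Bundles using (_⇔_)
open import Algebra.Bundles using (CommutativeRing)

record Field (c ℓ : Level) : Set (lsuc (c ⊔ ℓ)) where
  field
    commutativeRing : CommutativeRing c ℓ
  open CommutativeRing commutativeRing public
  field
    0≉1     : ¬ (0# ≈ 1#)
    inverse : ∀ x → ¬ (x ≈ 0#) → ∃ λ y → (x * y) ≈ 1#

module Geometry {c ℓ : Level} (F : Field c ℓ) (d : ℕ) where
  open Field F using (Carrier; _≈_; _+_; _*_; 0#; 1#)

  Point : Set c
  Point = Fin d → Carrier

  _≈ᵖ_ : Point → Point → Set ℓ
  x ≈ᵖ y = ∀ i → x i ≈ y i

  IsZero : Point → Set ℓ
  IsZero v = ∀ i → v i ≈ 0#

  sumFin : (n : ℕ) → (Fin n → Carrier) → Carrier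
  sumFin ℕ.zero  f = 0#
  sumFin (suc n) f = f Fin.zero + sumFin n (λ i → f (Fin.suc i))

  record Line : Set (c ⊔ ℓ) where
    constructor line
    field
      base   : Point
      dir    : Point
      dir≠0  : ¬ IsZero dir

  OnLine : Point → Line → Set (c ⊔ ℓ)
  OnLine x (line p v _) = ∃ λ t → ∀ i → x i ≈ (p i + t * v i)

  SameLine : Line → Line → Set (c ⊔ ℓ)
  SameLine l l' = ∀ x → OnLine x l ⇔ OnLine x l'

  record Hyperplane : Set (c ⊔ ℓ) where
    constructor hyperplane
    field
      normal    : Point
      offset    : Carrier
      normal≠0  : ¬ IsZero normal

  OnHyperplane : Point → Hyperplane → Set ℓ
  OnHyperplane x (hyperplane a b _) = sumFin d (λ i → a i * x i) ≈ b

  LineInHyperplane : Line → Hyperplane → Set (c ⊔ ℓ)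
  LineInHyperplane l H = ∀ x → OnLine x l → OnHyperplane x H

  DistinctLines : List Line → Set (c ⊔ ℓ)
  DistinctLines = AllPairs (λ l l' → ¬ SameLine l l')

  DistinctPoints : List Point → Set (c ⊔ ℓ)
  DistinctPoints = AllPairs (λ x y → ¬ (x ≈ᵖ y))

  IsJoint : (L : Fin d → List Line) → Point → Set (c ⊔ ℓ)
  IsJoint L x =
    Σ ((i : Fin d) → Fin (length (L i))) λ f →
        (∀ i → OnLine x (lookup (L i) (f i)))
      × (∀ i (k : Fin (length (L i))) → OnLine x (lookup (L i) k) → k ≡ f i)
      × ¬ (Σ Hyperplane λ H → ∀ i → LineInHyperplane (lookup (L i) (f i)) H)

module Submission where

-- The polynomial method with handicaps. Give every joint p a handicap x p and let B p ℓ = λ ℓ ∸ x p for each of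
-- its lines ℓ, where λ ℓ is so large that the B p ℓ along ℓ add up to at least n. If a polynomial g of degree < n,
-- expanded at every joint p along the lines through p, has no monomial with all exponents below the B p ℓ, then
-- g = 0: if g vanishes to order at least τ ∸ x q at all q, a leading exponent γ at p with |γ| = τ ∸ x p has
-- γᵢ ≥ B p ℓ for some ℓ, and the part of g with the other exponents fixed is a polynomial on ℓ with too many zeros,
-- so the order is at least (τ + 1) ∸ x p. Hence Σ_p Π_ℓ B p ℓ is at least the dimension of the space of polynomials
-- of degree < n. Raising the handicap of one joint at a time makes all the products Π_ℓ B p ℓ nearly equal, Hölder's
-- inequality bounds their common value from above by means of the sums along the lines, and n → ∞ gives the theorem.
-- The field has no decidable equality, but the conclusion is stable under double negation, and only finitely many
-- case distinctions in the field are made.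

open import Defs
open import Level as Level using (_⊔_)
open import Data.Fin.Base using (Fin; zero; suc; toℕ; _↑ˡ_; _↑ʳ_; splitAt; join)
import Data.Fin.Properties as Fin
open import Data.List.Base as List using (List; []; _∷_; _++_; length; concat; upTo; cartesianProductWith; tabulate)
open import Data.List.Membership.Propositional using (_∈_)
open import Data.List.Membership.Propositional.Properties using (∈-cartesianProductWith⁺; ∈-lookup; ∈-upTo⁺)
import Data.List.Properties as List
open import Data.List.Relation.Unary.All as All using (All; []; _∷_)
import Data.List.Relation.Unary.All.Properties as All
open import Data.List.Relation.Unary.AllPairs using (AllPairs; []; _∷_)
open import Data.List.Relation.Unary.Any using (here)
open import Data.Nat.Base as ℕ using (ℕ; zero; suc; pred; s≤s; z≤n)
open import Data.Nat.ListAction using (product)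
import Data.Nat.Properties as ℕ
open import Data.Nat.Tactic.RingSolver using (solve-∀)
open import Data.Product.Base using (∃; _×_; _,_; proj₁; proj₂)
open import Data.Sum.Base using (_⊎_; inj₁; inj₂)
open import Data.Vec.Base using (Vec; []; _∷_; _[_]≔_; lookup)
open import Data.Vec.Functional using (removeAt)
import Data.Vec.Properties as Vec
open import Effect.Monad using (RawMonad)
open import Function.Base using (_∘_)
open import Relation.Binary.Core using (Rel)
open import Relation.Binary.Definitions using (Symmetric)
open import Relation.Binary.PropositionalEquality as ≡ using (_≡_; _≢_)
open import Relation.Nullary using (¬_; Dec; yes; no)
open import Relation.Nullary.Decidable using (_×-dec_; decidable-stable; ¬¬-excluded-middle)
open import Relation.Nullary.Negation using (contradiction; ¬¬-map; ¬¬-Monad)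
open import Relation.Unary using (Decidable)

-- Lines carry different numbers of joints, so with equal handicaps a few joints may account for
-- almost all of Σ_p Π_ℓ B p ℓ. Hölder's inequality bounds the product at one joint only, a joint
-- that cannot be chosen freely; hence every product has to reach about 1/N of the dimension, N
-- being the number of joints. Raising x p takes from p alone: λ of its lines can only grow, so no
-- other joint loses, and p itself loses at most one unit in each factor. The difficulty is to show
-- that the raising stops. For this the dimension inequality is proved not just for all joints but
-- for every set of joints that contains, with a joint, all joints on its lines. Integrality costs
-- one unit per joint twice: λ is the least sufficient integer, and the factors carry a slack of
-- one. The sums along a line are thus at most n + 2N instead of n, which is harmless in the limit.
-- The factor d! comes from the dimension being at least n^d / d!. Orders of vanishing are read off
-- the coefficients of shifted polynomials and never off derivatives, so the argument is uniform in
-- the characteristic.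

module Counting where
  open import Data.Nat.Base
  open import Data.Nat.Properties
  open import Relation.Binary.PropositionalEquality
  open import Algebra.Properties.Semiring.Sum +-*-semiring public
    using () renaming (sum to ∑; sum-cong-≗ to ∑-cong; *-distribʳ-sum to *-distribʳ-∑)
  open import Algebra.Properties.CommutativeMonoid.Sum +-0-commutativeMonoid public
    using (∑-comm; ∑-distrib-+)
  open import Algebra.Properties.CommutativeMonoid.Sum *-1-commutativeMonoid public
    using () renaming (sum to ∏; sum-remove to ∏-remove; ∑-distrib-+ to ∏-distrib-*; sum-cong-≗ to ∏-cong)
  open ≤-Reasoning

  -- Sums, products and inequalities of natural numbers.

  _when_ : ∀ {a} {A : Set a} → ℕ → Dec A → ℕ
  m when yes _ = m
  m when no  _ = 0

  when-yes : ∀ {a} {A : Set a} (A? : Dec A) {m} → A → m when A? ≡ m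
  when-yes (yes _) a = refl
  when-yes (no ¬a) a = contradiction a ¬a

  when-no : ∀ {a} {A : Set a} (A? : Dec A) {m} → ¬ A → m when A? ≡ 0
  when-no (yes a) ¬a = contradiction a ¬a
  when-no (no _)  ¬a = refl

  when-mono : ∀ {a} {A : Set a} (A? : Dec A) {m n} → m ≤ n → m when A? ≤ n when A?
  when-mono (yes _) m≤n = m≤n
  when-mono (no _)  _   = z≤n

  ∑-mono : ∀ {n} {f g : Fin n → ℕ} → (∀ i → f i ≤ g i) → ∑ f ≤ ∑ g
  ∑-mono {zero}  f≤g = z≤n
  ∑-mono {suc n} f≤g = +-mono-≤ (f≤g zero) (∑-mono (f≤g ∘ suc))

  ∏-mono : ∀ {n} {f g : Fin n → ℕ} → (∀ i → f i ≤ g i) → ∏ f ≤ ∏ g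
  ∏-mono {zero}  f≤g = ≤-refl
  ∏-mono {suc n} f≤g = *-mono-≤ (f≤g zero) (∏-mono (f≤g ∘ suc))

  term≤∑ : ∀ {n} (f : Fin n → ℕ) i → f i ≤ ∑ f
  term≤∑ f zero    = m≤m+n _ _
  term≤∑ f (suc i) = ≤-trans (term≤∑ (f ∘ suc) i) (m≤n+m _ _)

  -- The number of monomials of degree < n in d variables: those free of the first variable, and
  -- those divisible by it, from which it is removed once.
  dimension : ℕ → ℕ → ℕ
  dimension d       zero    = 0
  dimension zero    (suc n) = 1
  dimension (suc d) (suc n) = dimension d (suc n) ℕ.+ dimension (suc d) n

  -- The tangent-line inequality for z^(k+1), with the subtraction moved to the other side.
  bernoulli : ∀ k z y → suc k * (z * y ^ k) ≤ z ^ suc k + k * y ^ suc k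
  bernoulli zero    z y = ≤-reflexive (eq z)
    where eq : ∀ z → 1 * (z * 1) ≡ z * 1 + 0
          eq = solve-∀
  -- With k z y^(k+1) + (k+1) z² y^k added to both sides, the claim is z times the induction
  -- hypothesis plus (k+1) y^k times 2zy ≤ z² + y².
  bernoulli (suc k) z y = +-cancelˡ-≤ (k * (z * (y * Y)) + suc k * (z * z * Y)) _ _ (begin
    k * (z * (y * Y)) + suc k * (z * z * Y) + suc (suc k) * (z * (y * Y))
      ≡⟨ eq₁ k z y Y ⟩
    z * (suc k * (z * Y)) + suc k * Y * (2 * (z * y))
      ≤⟨ +-mono-≤ (*-monoʳ-≤ z (bernoulli k z y)) (*-monoʳ-≤ (suc k * Y) 2zy≤) ⟩
    z * (z ^ suc k + k * (y * Y)) + suc k * Y * (z * z + y * y)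
      ≡⟨ eq₂ k z y Y (z ^ suc k) ⟩
    k * (z * (y * Y)) + suc k * (z * z * Y) + (z * z ^ suc k + suc k * (y * (y * Y))) ∎)
    where
    Y = y ^ k
    eq₁ : ∀ k z y Y → k * (z * (y * Y)) + suc k * (z * z * Y) + suc (suc k) * (z * (y * Y)) ≡
                      z * (suc k * (z * Y)) + suc k * Y * (2 * (z * y))
    eq₁ = solve-∀
    eq₂ : ∀ k z y Y Z → z * (Z + k * (y * Y)) + suc k * Y * (z * z + y * y) ≡
                        k * (z * (y * Y)) + suc k * (z * z * Y) + (z * Z + suc k * (y * (y * Y)))
    eq₂ = solve-∀
    square : ∀ a b → 2 * (a * (a + b)) ≤ a * a + (a + b) * (a + b)
    square a b = ≤-trans (m≤m+n _ (b * b)) (≤-reflexive (eq a b))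
      where eq : ∀ a b → 2 * (a * (a + b)) + b * b ≡ a * a + (a + b) * (a + b)
            eq = solve-∀
    2zy≤ : 2 * (z * y) ≤ z * z + y * y
    2zy≤ with ≤-total z y
    ... | inj₁ z≤y = subst (λ y → 2 * (z * y) ≤ z * z + y * y) (m+[n∸m]≡n z≤y) (square z (y ∸ z))
    ... | inj₂ y≤z = subst₂ _≤_ (cong (2 *_) (*-comm y z)) (+-comm (y * y) (z * z))
      (subst (λ z → 2 * (y * z) ≤ y * y + z * z) (m+[n∸m]≡n y≤z) (square y (z ∸ y)))

  ^-distribʳ-* : ∀ k m n → (m * n) ^ k ≡ m ^ k * n ^ k
  ^-distribʳ-* zero    m n = refl
  ^-distribʳ-* (suc k) m n = trans (cong (m * n *_) (^-distribʳ-* k m n)) (eq m n (m ^ k) (n ^ k))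
    where eq : ∀ m n M N → m * n * (M * N) ≡ m * M * (n * N)
          eq = solve-∀

  -- Induction, free of roots and quotients: for a first number x and k others of sum A, the step is
  -- `bernoulli` at z = k(x + A) and y = (k + 1)A, which coincide exactly when x is the mean of the
  -- others.
  am-gm : ∀ {n} (c : Fin n → ℕ) → n ^ n * ∏ c ≤ ∑ c ^ n
  am-gm {zero}        c = ≤-refl
  am-gm {suc zero}    c = ≤-reflexive (eq (c zero))
    where eq : ∀ x → 1 * (x * 1) ≡ (x + 0) * 1
          eq = solve-∀
  am-gm {suc (suc j)} c = *-cancelˡ-≤ (k ^ k) {{m^n≢0 k k}} (begin
    k ^ k * (suc k ^ suc k * (x * Π))     ≡⟨ eq₁ (k ^ k) (suc k ^ suc k) x Π ⟩
    suc k ^ suc k * x * (k ^ k * Π)       ≤⟨ *-monoʳ-≤ (suc k ^ suc k * x) (am-gm (c ∘ suc)) ⟩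
    suc k ^ suc k * x * A ^ k             ≤⟨ key ⟩
    k ^ k * (x + A) ^ suc k               ∎)
    where
    k = suc j
    x = c zero
    A = ∑ (c ∘ suc)
    Π = ∏ (c ∘ suc)
    eq₁ : ∀ K S x P → K * (S * (x * P)) ≡ S * x * (K * P)
    eq₁ = solve-∀
    key : suc k ^ suc k * x * A ^ k ≤ k ^ k * (x + A) ^ suc k
    key = *-cancelˡ-≤ k (+-cancelʳ-≤ (k * (suc k ^ suc k * A ^ suc k)) _ _ (begin
      k * (suc k ^ suc k * x * A ^ k) + k * (suc k ^ suc k * A ^ suc k)
        ≡⟨ eq₂ k (suc k ^ k) x A (A ^ k) ⟩
      suc k * (k * (x + A) * (suc k ^ k * A ^ k))
        ≡⟨ cong (λ v → suc k * (k * (x + A) * v)) (^-distribʳ-* k (suc k) A) ⟨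
      suc k * (k * (x + A) * (suc k * A) ^ k)
        ≤⟨ bernoulli k (k * (x + A)) (suc k * A) ⟩
      (k * (x + A)) ^ suc k + k * (suc k * A) ^ suc k
        ≡⟨ cong₂ (λ v w → v + k * w) (^-distribʳ-* (suc k) k (x + A)) (^-distribʳ-* (suc k) (suc k) A) ⟩
      k ^ suc k * (x + A) ^ suc k + k * (suc k ^ suc k * A ^ suc k)
        ≡⟨ cong (_+ k * (suc k ^ suc k * A ^ suc k)) (*-assoc k (k ^ k) ((x + A) ^ suc k)) ⟩
      k * (k ^ k * (x + A) ^ suc k) + k * (suc k ^ suc k * A ^ suc k) ∎))
      where
      eq₂ : ∀ k S x A B → k * (suc k * S * x * B) + k * (suc k * S * (A * B)) ≡ suc k * (k * (x + A) * (S * B))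
      eq₂ = solve-∀

  -- In fact d! times the dimension is (n + 1)(n + 2)...(n + d). The induction follows the recursion
  -- of `dimension`, with (n+1)^(d+1) - n^(d+1) ≤ (d+1)(n+1)^d as its step.
  dimension-lower-bound : ∀ d n → suc n ^ d ≤ d ! * dimension d (suc n)
  dimension-lower-bound zero    n = ≤-refl
  dimension-lower-bound (suc d) n = begin
    suc n ^ suc d                                                 ≤⟨ step ⟩
    suc d * suc n ^ d + n ^ suc d                                 ≤⟨ +-mono-≤ (*-monoʳ-≤ (suc d) (dimension-lower-bound d n)) (previous n) ⟩
    suc d * (d ! * dimension d (suc n)) + suc d ! * dimension (suc d) n ≡⟨ cong (_+ suc d ! * dimension (suc d) n) (*-assoc (suc d) (d !) _) ⟨
    suc d ! * dimension d (suc n) + suc d ! * dimension (suc d) n ≡⟨ *-distribˡ-+ (suc d !) _ _ ⟨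
    suc d ! * dimension (suc d) (suc n)                           ∎
    where
    previous : ∀ n → n ^ suc d ≤ suc d ! * dimension (suc d) n
    previous zero    = z≤n
    previous (suc n) = dimension-lower-bound (suc d) n
    step : suc n ^ suc d ≤ suc d * suc n ^ d + n ^ suc d
    step = +-cancelˡ-≤ (d * suc n ^ suc d) _ _ (begin
      d * suc n ^ suc d + suc n ^ suc d                      ≡⟨ eq d n (suc n ^ d) ⟩
      suc d * (n * suc n ^ d) + suc d * suc n ^ d            ≤⟨ +-monoˡ-≤ _ (bernoulli d n (suc n)) ⟩
      n ^ suc d + d * suc n ^ suc d + suc d * suc n ^ d      ≡⟨ eq′ (n ^ suc d) (d * suc n ^ suc d) (suc d * suc n ^ d) ⟩
      d * suc n ^ suc d + (suc d * suc n ^ d + n ^ suc d)    ∎)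
      where
      eq : ∀ d n Y → d * (suc n * Y) + suc n * Y ≡ suc d * (n * Y) + suc d * Y
      eq = solve-∀
      eq′ : ∀ a b c → a + b + c ≡ b + (c + a)
      eq′ = solve-∀

  -- (n + C)^d / n^d tends to 1.
  compare-leading : ∀ d C X Y → (∀ n → suc n ^ d * X ≤ Y * (suc n + C) ^ d) → X ≤ Y
  compare-leading d C X Y h = ≮⇒≥ λ Y<X → <⇒≱ (begin-strict
    n * Y + X * (d * C)    <⟨ +-monoʳ-< (n * Y) (n<1+n _) ⟩
    n * Y + n              ≡⟨ trans (+-comm (n * Y) n) (sym (*-suc n Y)) ⟩
    n * suc Y              ≤⟨ *-monoʳ-≤ n Y<X ⟩
    n * X                  ≡⟨ *-comm n X ⟩
    X * n                  ∎) bound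
    where
    -- Bernoulli turns the hypothesis into n(X - Y) ≤ X d C; if Y < X, this fails once n exceeds X d
    -- C.
    n = suc (X * (d * C))
    u = n + C
    bound : X * n ≤ n * Y + X * (d * C)
    bound = *-cancelʳ-≤ _ _ (u ^ d) {{m^n≢0 u d}} (+-cancelʳ-≤ (X * (d * n * u ^ d)) _ _ (begin
      X * n * u ^ d + X * (d * n * u ^ d)          ≡⟨ eq₁ X n d (u ^ d) ⟩
      X * (suc d * (n * u ^ d))                    ≤⟨ *-monoʳ-≤ X (bernoulli d n u) ⟩
      X * (n ^ suc d + d * u ^ suc d)              ≡⟨ eq₂ X n (n ^ d) d C (u ^ d) ⟩
      n * (n ^ d * X) + (X * (d * C) * u ^ d + X * (d * n * u ^ d)) ≤⟨ +-monoˡ-≤ _ (*-monoʳ-≤ n (h (X * (d * C)))) ⟩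
      n * (Y * u ^ d) + (X * (d * C) * u ^ d + X * (d * n * u ^ d)) ≡⟨ eq₃ n Y (u ^ d) (X * (d * C)) (X * (d * n * u ^ d)) ⟩
      (n * Y + X * (d * C)) * u ^ d + X * (d * n * u ^ d) ∎))
      where
      eq₁ : ∀ X n d U → X * n * U + X * (d * n * U) ≡ X * (suc d * (n * U))
      eq₁ = solve-∀
      eq₂ : ∀ X n E d C U → X * (n * E + d * ((n + C) * U)) ≡ n * (E * X) + (X * (d * C) * U + X * (d * n * U))
      eq₂ = solve-∀
      eq₃ : ∀ n Y U V W → n * (Y * U) + (V * U + W) ≡ (n * Y + V) * U + W
      eq₃ = solve-∀

  argmax : ∀ {n} (f : Fin (suc n) → ℕ) → ∃ λ p → ∀ q → f q ≤ f p
  argmax {zero}  f = zero , λ { zero → ≤-refl }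
  argmax {suc n} f with argmax (f ∘ suc)
  ... | p , max with ≤-total (f zero) (f (suc p))
  ...   | inj₁ f₀≤ = suc p , λ { zero → f₀≤ ; (suc q) → max q }
  ...   | inj₂ ≤f₀ = zero , λ { zero → ≤-refl ; (suc q) → ≤-trans (max q) ≤f₀ }

  argmin : ∀ {n} (f : Fin (suc n) → ℕ) → ∃ λ p → ∀ q → f p ≤ f q
  argmin {zero}  f = zero , λ { zero → ≤-refl }
  argmin {suc n} f with argmin (f ∘ suc)
  ... | p , min with ≤-total (f zero) (f (suc p))
  ...   | inj₁ f₀≤ = zero , λ { zero → ≤-refl ; (suc q) → ≤-trans f₀≤ (min q) }
  ...   | inj₂ ≤f₀ = suc p , λ { zero → ≤f₀ ; (suc q) → min q }

  ∑-const : ∀ n c → ∑ {n} (λ _ → c) ≡ n * c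
  ∑-const zero    c = refl
  ∑-const (suc n) c = cong (c +_) (∑-const n c)

  ∏-const : ∀ n c → ∏ {n} (λ _ → c) ≡ c ^ n
  ∏-const zero    c = refl
  ∏-const (suc n) c = cong (c *_) (∏-const n c)

  ∏-nonZero : ∀ {n} (f : Fin n → ℕ) → (∀ i → NonZero (f i)) → NonZero (∏ f)
  ∏-nonZero {zero}  f nz = _
  ∏-nonZero {suc n} f nz = m*n≢0 (f zero) (∏ (f ∘ suc)) {{nz zero}} {{∏-nonZero (f ∘ suc) (nz ∘ suc)}}

  -- Hölder's inequality for the minimum of the products: choose p with Σᵢ a p i / Sᵢ at most the average d / N,
  -- where Sᵢ = Σ_p a p i, and apply AM-GM to these d ratios.
  hölder-min : ∀ {n d} (a : Fin (suc n) → Fin (suc d) → ℕ) → (∀ p i → NonZero (a p i)) →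
    ∃ λ p → suc n ^ suc d * ∏ (a p) ≤ ∏ (λ i → ∑ (λ p → a p i))
  hölder-min {n} {d} a a≢0 = p , *-cancelʳ-≤ _ _ (∏ cof) {{cof≢0}} (*-cancelˡ-≤ (D ^ D) {{m^n≢0 D D}} (begin
    D ^ D * (N ^ D * ∏ (a p) * ∏ cof)      ≡⟨ eq (D ^ D) (N ^ D) (∏ (a p)) (∏ cof) ⟩
    N ^ D * (D ^ D * (∏ (a p) * ∏ cof))    ≡⟨ cong (λ v → N ^ D * (D ^ D * v)) (∏-distrib-* (a p) cof) ⟨
    N ^ D * (D ^ D * ∏ (c p))              ≤⟨ *-monoʳ-≤ (N ^ D) (am-gm (c p)) ⟩
    N ^ D * ∑ (c p) ^ D                    ≡⟨ ^-distribʳ-* D N (∑ (c p)) ⟨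
    (N * ∑ (c p)) ^ D                      ≤⟨ ^-monoˡ-≤ D below-average ⟩
    (D * Q) ^ D                            ≡⟨ ^-distribʳ-* D D Q ⟩
    D ^ D * Q ^ D                          ≡⟨ cong (D ^ D *_) Q^D ⟩
    D ^ D * (Q * ∏ cof)                    ∎))
    where
    N = suc n
    D = suc d
    S : Fin D → ℕ
    S i = ∑ (λ p → a p i)
    Q = ∏ S
    -- `cof i` is Q / S i, so `c p i` is the ratio a p i / S i with the common denominator Q
    -- cleared.
    cof : Fin D → ℕ
    cof i = ∏ (removeAt S i)
    c : Fin N → Fin D → ℕ
    c p i = a p i * cof i
    S*cof : ∀ i → S i * cof i ≡ Q
    S*cof i = sym (∏-remove {i = i} S)
    Q^D : Q ^ D ≡ Q * ∏ cof
    Q^D = trans (sym (∏-const D Q)) (trans (∏-cong (λ i → sym (S*cof i))) (∏-distrib-* S cof))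
    S≢0 : ∀ i → NonZero (S i)
    S≢0 i = >-nonZero (≤-trans (>-nonZero⁻¹ _ {{a≢0 zero i}}) (term≤∑ (λ p → a p i) zero))
    cof≢0 : NonZero (∏ cof)
    cof≢0 = m*n≢0⇒n≢0 Q {{subst NonZero Q^D (m^n≢0 Q D {{∏-nonZero S S≢0}})}}
    p = proj₁ (argmin (λ p → ∑ (c p)))
    total : ∑ (λ p → ∑ (c p)) ≡ D * Q
    total = trans (∑-comm c) (trans (∑-cong (λ i → trans (sym (*-distribʳ-∑ (cof i) (λ p → a p i))) (S*cof i))) (∑-const D Q))
    below-average : N * ∑ (c p) ≤ D * Q
    below-average = subst₂ _≤_ (∑-const N (∑ (c p))) total (∑-mono (proj₂ (argmin (λ p → ∑ (c p)))))
    eq : ∀ A B C E → A * (B * C * E) ≡ B * (A * (C * E))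
    eq = solve-∀

  least : ∀ {a} {P : ℕ → Set a} → Decidable P → ∀ b → P b → ∃ λ l → P l × (∀ {k} → P k → l ≤ k)
  least P? zero    Pb = zero , Pb , λ _ → z≤n
  least P? (suc b) Pb with P? zero
  ... | yes P0 = zero , P0 , λ _ → z≤n
  ... | no ¬P0 with l , Pl , min ← least (P? ∘ suc) b Pb =
    suc l , Pl , λ { {zero} P0 → contradiction P0 ¬P0 ; {suc k} Pk → s≤s (min Pk) }

  ∑-mono-< : ∀ {n} {f g : Fin n → ℕ} → (∀ i → f i ≤ g i) → ∀ i → f i < g i → ∑ f < ∑ g
  ∑-mono-< f≤g zero    f<g = +-mono-<-≤ f<g (∑-mono (f≤g ∘ suc))
  ∑-mono-< f≤g (suc i) f<g = +-mono-≤-< (f≤g zero) (∑-mono-< (f≤g ∘ suc) i f<g)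

  -- Balancing the handicaps, with a configuration known only through the labels of its lines.

  module Balancing {d N : ℕ} {m : Fin d → ℕ} (lab : Fin N → ∀ i → Fin (m i)) (n D : ℕ) where

    -- Zeros available on the line ℓ, counted with multiplicity; `level` is the candidate for the λ
    -- of that line.
    multiplicity : (Fin N → ℕ) → ∀ i → Fin (m i) → ℕ → ℕ
    multiplicity x i ℓ level = ∑ (λ q → (level ∸ x q) when (ℓ Fin.≟ lab q i))

    multiplicity-antitone : ∀ {x x′} → (∀ q → x q ≤ x′ q) → ∀ i ℓ level → multiplicity x′ i ℓ level ≤ multiplicity x i ℓ level
    multiplicity-antitone x≤x′ i ℓ level = ∑-mono (λ q → when-mono (ℓ Fin.≟ lab q i) (∸-monoʳ-≤ level (x≤x′ q)))

    term≤multiplicity : ∀ x p q i level → lab p i ≡ lab q i → level ∸ x q ≤ multiplicity x i (lab p i) level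
    term≤multiplicity x p q i level eq = subst (_≤ multiplicity x i (lab p i) level) (when-yes (lab p i Fin.≟ lab q i) eq)
      (term≤∑ (λ q → (level ∸ x q) when (lab p i Fin.≟ lab q i)) q)

    threshold∃ : ∀ x p i → ∃ λ l → n ≤ multiplicity x i (lab p i) l × (∀ {k} → n ≤ multiplicity x i (lab p i) k → l ≤ k)
    -- At level n + x p the joint p alone contributes n, so the search for the least level is
    -- bounded.
    threshold∃ x p i = least (λ l → n ≤? multiplicity x i (lab p i) l) (n + x p)
      (subst (_≤ multiplicity x i (lab p i) (n + x p)) (m+n∸n≡m n (x p)) (term≤multiplicity x p p i (n + x p) refl))

    threshold : (Fin N → ℕ) → Fin N → Fin d → ℕ
    threshold x p i = proj₁ (threshold∃ x p i)

    threshold-enough : ∀ x p i → n ≤ multiplicity x i (lab p i) (threshold x p i)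
    threshold-enough x p i = proj₁ (proj₂ (threshold∃ x p i))

    threshold-least : ∀ x p i {k} → n ≤ multiplicity x i (lab p i) k → threshold x p i ≤ k
    threshold-least x p i = proj₂ (proj₂ (threshold∃ x p i))

    threshold-line : ∀ x p q i → lab p i ≡ lab q i → threshold x q i ≤ threshold x p i
    threshold-line x p q i eq = threshold-least x q i
      (subst (λ ℓ → n ≤ multiplicity x i ℓ (threshold x p i)) eq (threshold-enough x p i))

    threshold-mono : ∀ {x x′} → (∀ q → x q ≤ x′ q) → ∀ p i → threshold x p i ≤ threshold x′ p i
    threshold-mono {x} {x′} x≤x′ p i = threshold-least x p i
      (≤-trans (threshold-enough x′ p i) (multiplicity-antitone x≤x′ i (lab p i) (threshold x′ p i)))

    suc-∸-when : ∀ {a} {A : Set a} (A? : Dec A) l y → (suc l ∸ y) when A? ≤ (l ∸ y) when A? + 1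
    suc-∸-when (yes _) l y = m≤n+o⇒m∸n≤o (suc l) y
      (≤-trans (s≤s (m≤n+m∸n l y)) (≤-reflexive (trans (sym (+-suc y (l ∸ y))) (cong (y +_) (+-comm 1 (l ∸ y))))))
    suc-∸-when (no _)  l y = z≤n

    multiplicity-suc : ∀ x i ℓ l → multiplicity x i ℓ (suc l) ≤ multiplicity x i ℓ l + N
    multiplicity-suc x i ℓ l = begin
      multiplicity x i ℓ (suc l)                                  ≤⟨ ∑-mono (λ q → suc-∸-when (ℓ Fin.≟ lab q i) l (x q)) ⟩
      ∑ (λ q → (l ∸ x q) when (ℓ Fin.≟ lab q i) + 1)              ≡⟨ ∑-distrib-+ (λ q → (l ∸ x q) when (ℓ Fin.≟ lab q i)) (λ _ → 1) ⟩
      multiplicity x i ℓ l + ∑ {N} (λ _ → 1)                      ≡⟨ cong (multiplicity x i ℓ l +_) (trans (∑-const N 1) (*-identityʳ N)) ⟩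
      multiplicity x i ℓ l + N                                    ∎

    multiplicity-zero : ∀ x i ℓ → multiplicity x i ℓ 0 ≤ 0
    multiplicity-zero x i ℓ = ≤-trans (∑-mono (λ q → bound (ℓ Fin.≟ lab q i) (x q))) (≤-reflexive (trans (∑-const N 0) (*-zeroʳ N)))
      where
      bound : ∀ {a} {A : Set a} (A? : Dec A) y → (0 ∸ y) when A? ≤ 0
      bound (yes _) y = ≤-reflexive (0∸n≡0 y)
      bound (no _)  y = z≤n

    -- One level below the threshold the sum is still less than n, and one level adds at most one
    -- per joint.
    multiplicity-bounded : ∀ x p i → multiplicity x i (lab p i) (threshold x p i) ≤ n + N
    multiplicity-bounded x p i with threshold x p i | (λ {k} → threshold-least x p i {k})
    ... | zero  | _     = ≤-trans (multiplicity-zero x i (lab p i)) z≤n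
    ... | suc l | least = ≤-trans (multiplicity-suc x i (lab p i) l)
      (+-monoˡ-≤ N (≮⇒≥ λ n<mult → 1+n≰n (least (<⇒≤ n<mult))))

    share : (Fin N → ℕ) → Fin N → Fin d → ℕ
    share x p i = threshold x p i ∸ x p

    -- The `suc` is the slack that survives a raise: if the bare shares of p are large enough, p is
    -- good after its handicap goes up by one, when each share has dropped by at most one.
    Good : (Fin N → ℕ) → Fin N → Set
    Good x p = D ≤ N * ∏ (λ i → suc (share x p i))

    good? : ∀ x p → Dec (Good x p)
    good? x p = D ≤? N * ∏ (λ i → suc (share x p i))

    -- Bounds the total multiplicity on a line at its threshold, hence also the spread of handicaps
    -- that can arise along a line.
    G : ℕ
    G = n + N

    -- The handicap of p goes up; what is lowered is the contribution of p at a given level.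
    lower : (Fin N → ℕ) → Fin N → Fin N → ℕ
    lower x p q = x q + 1 when (p Fin.≟ q)

    -- One N is the overshoot of the threshold, the other the slack of one per joint. Thresholds are
    -- indexed by joints, so a joint on ℓ has to be found first; without one the sum is empty.
    line-share≤ : ∀ x i ℓ → ∑ (λ p → suc (share x p i) when (ℓ Fin.≟ lab p i)) ≤ n + (N + N)
    line-share≤ x i ℓ with Fin.any? (λ p → ℓ Fin.≟ lab p i)
    ... | no none = ≤-trans (∑-mono empty) (≤-trans (≤-reflexive (trans (∑-const N 0) (*-zeroʳ N))) z≤n)
      where
      empty : ∀ p → suc (share x p i) when (ℓ Fin.≟ lab p i) ≤ 0
      empty p with ℓ Fin.≟ lab p i
      ... | yes eq = contradiction (p , eq) none
      ... | no _   = z≤n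
    ... | yes (p , refl) = begin
      ∑ (λ q → suc (share x q i) when (lab p i Fin.≟ lab q i))   ≤⟨ ∑-mono share≤ ⟩
      ∑ (λ q → (threshold x p i ∸ x q) when (lab p i Fin.≟ lab q i) + 1) ≡⟨ ∑-distrib-+ (λ q → (threshold x p i ∸ x q) when (lab p i Fin.≟ lab q i)) (λ _ → 1) ⟩
      multiplicity x i (lab p i) (threshold x p i) + ∑ {N} (λ _ → 1) ≤⟨ +-mono-≤ (multiplicity-bounded x p i) (≤-reflexive (trans (∑-const N 1) (*-identityʳ N))) ⟩
      n + N + N                                                  ≡⟨ +-assoc n N N ⟩
      n + (N + N)                                                ∎
      where
      share≤ : ∀ q → suc (share x q i) when (lab p i Fin.≟ lab q i) ≤ (threshold x p i ∸ x q) when (lab p i Fin.≟ lab q i) + 1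
      share≤ q with lab p i Fin.≟ lab q i
      ... | yes eq = ≤-trans (s≤s (∸-monoˡ-≤ (x q) (threshold-line x p q i eq))) (≤-reflexive (+-comm 1 _))
      ... | no _   = z≤n

    total-share≤ : ∀ x i → ∑ (λ p → suc (share x p i)) ≤ m i * (n + (N + N))
    total-share≤ x i = begin
      ∑ (λ p → suc (share x p i))                                              ≤⟨ ∑-mono on-own-line ⟩
      ∑ (λ p → ∑ (λ ℓ → suc (share x p i) when (ℓ Fin.≟ lab p i)))             ≡⟨ ∑-comm (λ p ℓ → suc (share x p i) when (ℓ Fin.≟ lab p i)) ⟩
      ∑ (λ ℓ → ∑ (λ p → suc (share x p i) when (ℓ Fin.≟ lab p i)))             ≤⟨ ∑-mono (line-share≤ x i) ⟩
      ∑ {m i} (λ _ → n + (N + N))                                              ≡⟨ ∑-const (m i) _ ⟩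
      m i * (n + (N + N))                                                      ∎
      where
      on-own-line : ∀ p → suc (share x p i) ≤ ∑ (λ ℓ → suc (share x p i) when (ℓ Fin.≟ lab p i))
      on-own-line p = subst (_≤ ∑ (λ ℓ → suc (share x p i) when (ℓ Fin.≟ lab p i)))
        (when-yes (lab p i Fin.≟ lab p i) refl) (term≤∑ (λ ℓ → suc (share x p i) when (ℓ Fin.≟ lab p i)) (lab p i))

    -- `zero⊎good`: only rich joints are raised, and they stay good. `lipschitz` makes the joints
    -- below a gap a union of whole lines. `bounded` forces the process to end; raises happen only
    -- at handicaps up to N G.
    record Invariant (x : Fin N → ℕ) : Set where
      field
        zero⊎good : ∀ p → x p ≡ 0 ⊎ Good x p
        lipschitz : ∀ p q i → lab p i ≡ lab q i → x p ≤ x q + G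
        bounded   : ∀ p → x p ≤ suc (N * G)

    module Step (1≤D : 1 ≤ D) {x} (inv : Invariant x) (p : Fin N) (x≤ : x p ≤ N * G)
                (rich : D ≤ N * ∏ (share x p)) where
      open Invariant inv

      x′ : Fin N → ℕ
      x′ = lower x p

      x≤x′ : ∀ q → x q ≤ x′ q
      x≤x′ q = m≤m+n (x q) _

      x′-here : ∀ {q} → p ≡ q → x′ q ≡ suc (x q)
      x′-here {q} p≡q = trans (cong (x q +_) (when-yes (p Fin.≟ q) p≡q)) (+-comm (x q) 1)

      x′-there : ∀ {q} → p ≢ q → x′ q ≡ x q
      x′-there {q} p≢q = trans (cong (x q +_) (when-no (p Fin.≟ q) p≢q)) (+-identityʳ (x q))

      share-pos : ∀ i → 0 < share x p i
      share-pos i = pos (share x p) (n≢0⇒n>0 λ ∏≡0 → n≮0 (≤-trans 1≤D (≤-trans rich (≤-reflexive (trans (cong (N *_) ∏≡0) (*-zeroʳ N)))))) i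
        where
        pos : ∀ {k} (f : Fin k → ℕ) → 0 < ∏ f → ∀ i → 0 < f i
        pos f ∏>0 zero    = n≢0⇒n>0 λ f≡0 → n≮0 (subst (λ a → 0 < a * ∏ (f ∘ suc)) f≡0 ∏>0)
        pos f ∏>0 (suc i) = pos (f ∘ suc) (n≢0⇒n>0 λ e → n≮0 (subst (0 <_) (trans (cong (f zero *_) e) (*-zeroʳ (f zero))) ∏>0)) i

      good-here : Good x′ p
      good-here = ≤-trans rich (*-monoʳ-≤ N (∏-mono (λ i → begin
        threshold x p i ∸ x p               ≤⟨ ∸-monoˡ-≤ (x p) (threshold-mono x≤x′ p i) ⟩
        threshold x′ p i ∸ x p              ≤⟨ m≤n+o⇒m∸n≤o (threshold x′ p i) (x p) (bound (threshold x′ p i)) ⟩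
        suc (threshold x′ p i ∸ suc (x p))  ≡⟨ cong (λ y → suc (threshold x′ p i ∸ y)) (x′-here refl) ⟨
        suc (share x′ p i)                  ∎)))
        where
        bound : ∀ t → t ≤ x p + suc (t ∸ suc (x p))
        bound t = ≤-trans (m≤n+m∸n t (suc (x p))) (≤-reflexive (sym (+-suc (x p) _)))

      good-there : ∀ {q} → p ≢ q → Good x q → Good x′ q
      good-there {q} p≢q good = ≤-trans good (*-monoʳ-≤ N (∏-mono (λ i → s≤s (begin
        threshold x q i ∸ x q    ≤⟨ ∸-monoˡ-≤ (x q) (threshold-mono x≤x′ q i) ⟩
        threshold x′ q i ∸ x q   ≡⟨ cong (threshold x′ q i ∸_) (x′-there p≢q) ⟨
        share x′ q i             ∎))))

      good′ : ∀ q → Dec (p ≡ q) → x′ q ≡ 0 ⊎ Good x′ q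
      good′ q (yes refl) = inj₂ good-here
      good′ q (no p≢q) with zero⊎good q
      ... | inj₁ x≡0  = inj₁ (trans (x′-there p≢q) x≡0)
      ... | inj₂ good = inj₂ (good-there p≢q good)

      lipschitz′ : ∀ r q i → lab r i ≡ lab q i → Dec (p ≡ r) → x′ r ≤ x′ q + G
      lipschitz′ r q i eq (no p≢r) = begin
        x′ r        ≡⟨ x′-there p≢r ⟩
        x r         ≤⟨ lipschitz r q i eq ⟩
        x q + G     ≤⟨ +-monoˡ-≤ G (x≤x′ q) ⟩
        x′ q + G    ∎
      -- The shares of the rich joint p are positive, so x p lies below the threshold of the line,
      -- which exceeds x q by at most the contribution of q, and that is at most G.
      lipschitz′ r q i eq (yes refl) = begin
        x′ p                               ≡⟨ x′-here refl ⟩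
        suc (x p)                          ≤⟨ m∸n≢0⇒n<m (>⇒≢ (share-pos i)) ⟩
        threshold x p i                    ≤⟨ m≤n+m∸n (threshold x p i) (x q) ⟩
        x q + (threshold x p i ∸ x q)      ≤⟨ +-monoʳ-≤ (x q) (≤-trans (term≤multiplicity x p q i (threshold x p i) eq) (multiplicity-bounded x p i)) ⟩
        x q + G                            ≤⟨ +-monoˡ-≤ G (x≤x′ q) ⟩
        x′ q + G                           ∎

      bounded′ : ∀ q → Dec (p ≡ q) → x′ q ≤ suc (N * G)
      bounded′ q (yes refl) = ≤-trans (≤-reflexive (x′-here refl)) (s≤s x≤)
      bounded′ q (no p≢q)   = ≤-trans (≤-reflexive (x′-there p≢q)) (bounded q)

      inv′ : Invariant x′
      inv′ = record { zero⊎good = λ q → good′ q (p Fin.≟ q)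
        ; lipschitz = λ r q i eq → lipschitz′ r q i eq (p Fin.≟ r)
        ; bounded = λ q → bounded′ q (p Fin.≟ q) }

      increases : ∑ x < ∑ x′
      increases = ∑-mono-< x≤x′ p (≤-reflexive (sym (x′-here refl)))

    -- N values leave one of N + 1 disjoint intervals of length G empty.
    gap : 1 ≤ G → ∀ x → ∃ λ (k : Fin (suc N)) → ∀ p → x p ≤ toℕ k * G + G → x p ≤ toℕ k * G
    gap 1≤G x with Fin.all? (λ k → Fin.any? (λ p → (toℕ k * G <? x p) ×-dec (x p ≤? toℕ k * G + G)))
    ... | no ¬all with k , none ← Fin.¬∀⟶∃¬ (suc N) _ (λ k → Fin.any? (λ p → (toℕ k * G <? x p) ×-dec (x p ≤? toℕ k * G + G))) ¬all =
      k , λ p le → ≮⇒≥ λ gt → none (p , gt , le)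
    ... | yes hit with i , j , i<j , eq ← Fin.pigeonhole (n<1+n N) (λ k → proj₁ (hit k)) =
      contradiction (begin-strict
        toℕ i * G + G           ≡⟨ +-comm (toℕ i * G) G ⟩
        suc (toℕ i) * G         ≤⟨ *-monoˡ-≤ G i<j ⟩
        toℕ j * G               <⟨ proj₁ (proj₂ (hit j)) ⟩
        x (proj₁ (hit j))       ≡⟨ cong x eq ⟨
        x (proj₁ (hit i))       ≤⟨ proj₂ (proj₂ (hit i)) ⟩
        toℕ i * G + G           ∎) (<-irrefl refl)

  average≤max : ∀ {N} (f : Fin N → ℕ) D → 1 ≤ D → D ≤ ∑ f → ∃ λ p → D ≤ N * f p
  average≤max {zero}  f D 1≤D D≤ = contradiction (≤-trans 1≤D D≤) n≮0
  average≤max {suc N} f D 1≤D D≤ with p , max ← argmax f =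
    p , ≤-trans D≤ (≤-trans (∑-mono max) (≤-reflexive (∑-const (suc N) (f p))))

  -- The hypothesis `total` is the dimension inequality for a set K of joints closed along lines.
  -- Taken as an assumption, it leaves the balancing purely arithmetical.
  module _ {d N : ℕ} {m : Fin d → ℕ} (lab : Fin N → ∀ i → Fin (m i)) (n D : ℕ) (1≤n : 1 ≤ n) (1≤D : 1 ≤ D)
    (total : ∀ (x : Fin N → ℕ) (level : Fin N → Fin d → ℕ) {K : Fin N → Set} →
      (∀ {p q} i → K p → lab p i ≡ lab q i → K q) →
      (∀ {p} → K p → ∀ i → n ≤ ∑ (λ q → (level p i ∸ x q) when (lab p i Fin.≟ lab q i))) →
      (K? : Decidable K) → ∃ K → D ≤ ∑ (λ p → ∏ (λ i → level p i ∸ x p) when K? p))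
    where
    open Balancing lab n D
    open Invariant

    -- The handicap x p of a point is increased while its share is too large. Points that carry too small a share
    -- have handicap 0; below a gap in the handicaps the points form a union of whole lines, so one of them is rich.
    improve : ∀ {x} → Invariant x → ∀ p₀ → ¬ Good x p₀ → ∃ λ x′ → Invariant x′ × ∑ x < ∑ x′
    improve {x} inv p₀ bad with gap (≤-trans 1≤n (m≤m+n n N)) x
    ... | k , is-gap = rich-step (average≤max (λ p → ∏ (share x p) when K? p) D 1≤D
          (total x (threshold x) closed (λ {p} _ → threshold-enough x p) K? (p₀ , K-p₀)))
      where
      K : Fin N → Set
      K p = x p ≤ toℕ k * G
      K? : Decidable K
      K? p = x p ≤? toℕ k * G
      closed : ∀ {p q} i → K p → lab p i ≡ lab q i → K q
      closed {p} {q} i Kp eq = is-gap q (≤-trans (lipschitz inv q p i (sym eq)) (+-monoˡ-≤ G Kp))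
      K-p₀ : K p₀
      K-p₀ with zero⊎good inv p₀
      ... | inj₁ x≡0  = ≤-trans (≤-reflexive x≡0) z≤n
      ... | inj₂ good = contradiction good bad
      rich-step : ∃ (λ p → D ≤ N * (∏ (share x p) when K? p)) → ∃ λ x′ → Invariant x′ × ∑ x < ∑ x′
      rich-step (p , rich) with K? p
      ... | yes Kp = x′ , inv′ , increases
        where open Step 1≤D inv p (≤-trans Kp (*-monoˡ-≤ G (≤-pred (Fin.toℕ<n k)))) rich
      ... | no _ = contradiction (≤-trans 1≤D (≤-trans rich (≤-reflexive (*-zeroʳ N)))) n≮0

    -- Every raise increases the sum of the handicaps, so s unsuccessful rounds push it to at least
    -- s; `Invariant.bounded` refutes this for large s.
    search : ∀ s → (∃ λ x → ∀ p → Good x p) ⊎ (∃ λ x → Invariant x × s ≤ ∑ x)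
    search zero = inj₂ ((λ _ → 0) , record
      { zero⊎good = λ _ → inj₁ refl ; lipschitz = λ _ _ _ _ → z≤n ; bounded = λ _ → z≤n } , z≤n)
    search (suc s) with search s
    ... | inj₁ done = inj₁ done
    ... | inj₂ (x , inv , s≤) with Fin.all? (good? x)
    ...   | yes good = inj₁ (x , good)
    ...   | no ¬good with p₀ , bad ← Fin.¬∀⟶∃¬ N _ (good? x) ¬good with x′ , inv′ , ∑< ← improve inv p₀ bad =
      inj₂ (x′ , inv′ , ≤-<-trans s≤ ∑<)

    balanced : ∃ λ x → ∀ p → Good x p
    balanced with search (suc (N * suc (N * G)))
    ... | inj₁ done = done
    ... | inj₂ (x , inv , large) = contradiction (≤-trans large
      (≤-trans (∑-mono (bounded inv)) (≤-reflexive (∑-const N _)))) 1+n≰n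

    fair-shares : ∃ λ (a : Fin N → Fin d → ℕ) → (∀ p i → NonZero (a p i)) × (∀ p → D ≤ N * ∏ (a p)) ×
      (∀ i → ∑ (λ p → a p i) ≤ m i * (n + (N + N)))
    fair-shares with x , good ← balanced =
      (λ p i → suc (share x p i)) , (λ _ _ → _) , good , total-share≤ x

open Counting using (∑; ∏; ∑-cong; ∑-mono; ∏-mono; ∏-const; ∏-distrib-*; _when_; dimension;
  dimension-lower-bound; compare-leading; hölder-min; fair-shares)

-- Linear algebra up to double negation.

module LinearAlgebra {c ℓ} (F : Field c ℓ) where
  open Field F hiding (zero)
  open import Algebra.Properties.Semiring.Sum semiring using (sum; sum-cong-≋)
  open import Algebra.Properties.Ring ring using (-1*x≈-x)
  open import Algebra.Solver.Ring.NaturalCoefficients.Default commutativeSemiring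
  open import Relation.Binary.Reasoning.Setoid setoid

  infix 4 _≋_
  infixl 6 _⊕_
  infixr 7 _⊙_

  _≋_ : {I : Set} → (I → Carrier) → (I → Carrier) → Set ℓ
  h ≋ k = ∀ i → h i ≈ k i

  _⊕_ : {I : Set} → (I → Carrier) → (I → Carrier) → I → Carrier
  (h ⊕ k) i = h i + k i

  _⊙_ : {I : Set} → Carrier → (I → Carrier) → I → Carrier
  (a ⊙ h) i = a * h i

  𝟘 : {I : Set} → I → Carrier
  𝟘 _ = 0#

  -- Differences are written with the scalar `-1#`, so that rearrangements are identities of
  -- commutative semirings and cancellation is isolated in `x+-1*x≈0`.
  -1# : Carrier
  -1# = - 1#

  x+-1*x≈0 : ∀ x → x + -1# * x ≈ 0#
  x+-1*x≈0 x = trans (+-congˡ (-1*x≈-x x)) (-‿inverseʳ x)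

  -- Arbitrary index sets let one notion serve coordinate vectors, multivariate coefficients and
  -- univariate sequences.
  record Linear {I : Set} (φ : (I → Carrier) → Carrier) : Set (c ⊔ ℓ) where
    field
      ≋-cong : ∀ {h k} → h ≋ k → φ h ≈ φ k
      ⊕-homo : ∀ h k → φ (h ⊕ k) ≈ φ h + φ k
      ⊙-homo : ∀ a h → φ (a ⊙ h) ≈ a * φ h

    𝟘-homo : φ 𝟘 ≈ 0#
    𝟘-homo = begin
      φ 𝟘         ≈⟨ ≋-cong (λ _ → sym (zeroˡ 0#)) ⟩
      φ (0# ⊙ 𝟘)  ≈⟨ ⊙-homo 0# 𝟘 ⟩
      0# * φ 𝟘    ≈⟨ zeroˡ _ ⟩
      0#          ∎

    sum-homo : ∀ {n} (a : Fin n → Carrier) (h : Fin n → I → Carrier) →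
      φ (λ i → sum (λ j → a j * h j i)) ≈ sum (λ j → a j * φ (h j))
    sum-homo {zero}  a h = 𝟘-homo
    sum-homo {suc n} a h = trans (⊕-homo (a zero ⊙ h zero) _)
      (+-cong (⊙-homo (a zero) (h zero)) (sum-homo (a ∘ suc) (h ∘ suc)))

  open Linear public

  LinearMap : {I J : Set} → ((I → Carrier) → J → Carrier) → Set (c ⊔ ℓ)
  LinearMap T = ∀ j → Linear (λ h → T h j)

  eval-linear : {I : Set} (i : I) → Linear (λ h → h i)
  eval-linear i = record
    { ≋-cong = λ h≋k → h≋k i ; ⊕-homo = λ _ _ → refl ; ⊙-homo = λ _ _ → refl }

  zero-linear : {I : Set} → Linear {I} (λ _ → 0#)
  zero-linear = record
    { ≋-cong = λ _ → refl ; ⊕-homo = λ _ _ → sym (+-identityʳ 0#) ; ⊙-homo = λ a _ → sym (zeroʳ a) }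

  +-linear : {I : Set} {φ ψ : (I → Carrier) → Carrier} →
    Linear φ → Linear ψ → Linear (λ h → φ h + ψ h)
  +-linear {φ = φ} {ψ} Lφ Lψ = record
    { ≋-cong = λ e → +-cong (≋-cong Lφ e) (≋-cong Lψ e)
    ; ⊕-homo = λ h k → trans (+-cong (⊕-homo Lφ h k) (⊕-homo Lψ h k))
        (solve 4 (λ a b x y → (a :+ b) :+ (x :+ y) := (a :+ x) :+ (b :+ y)) refl _ _ _ _)
    ; ⊙-homo = λ a h → trans (+-cong (⊙-homo Lφ a h) (⊙-homo Lψ a h)) (sym (distribˡ a _ _))
    }

  *-linear : {I : Set} {φ : (I → Carrier) → Carrier} (b : Carrier) →
    Linear φ → Linear (λ h → b * φ h)
  *-linear b Lφ = record
    { ≋-cong = λ e → *-congˡ (≋-cong Lφ e)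
    ; ⊕-homo = λ h k → trans (*-congˡ (⊕-homo Lφ h k)) (distribˡ b _ _)
    ; ⊙-homo = λ a h → trans (*-congˡ (⊙-homo Lφ a h))
        (solve 3 (λ b a x → b :* (a :* x) := a :* (b :* x)) refl _ _ _)
    }

  sum-linear : ∀ {I : Set} {n} {φ : Fin n → (I → Carrier) → Carrier} →
    (∀ j → Linear (φ j)) → Linear (λ h → sum (λ j → φ j h))
  sum-linear {n = zero}  L = zero-linear
  sum-linear {n = suc n} L = +-linear (L zero) (sum-linear (L ∘ suc))

  ∘-linear : ∀ {I J : Set} {φ : (J → Carrier) → Carrier} {T : (I → Carrier) → J → Carrier} →
    Linear φ → LinearMap T → Linear (φ ∘ T)
  ∘-linear Lφ LT = record
    { ≋-cong = λ e → ≋-cong Lφ (λ j → ≋-cong (LT j) e)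
    ; ⊕-homo = λ h k → trans (≋-cong Lφ (λ j → ⊕-homo (LT j) h k)) (⊕-homo Lφ _ _)
    ; ⊙-homo = λ a h → trans (≋-cong Lφ (λ j → ⊙-homo (LT j) a h)) (⊙-homo Lφ _ _)
    }

  δ : ∀ {n} → Fin n → Fin n → Carrier
  δ zero    zero    = 1#
  δ zero    (suc _) = 0#
  δ (suc _) zero    = 0#
  δ (suc i) (suc j) = δ i j

  sum-zero : ∀ {n} {f : Fin n → Carrier} → (∀ i → f i ≈ 0#) → sum f ≈ 0#
  sum-zero {zero}  f≈0 = refl
  sum-zero {suc n} f≈0 = trans (+-cong (f≈0 zero) (sum-zero (f≈0 ∘ suc))) (+-identityʳ 0#)

  sum-δ : ∀ {n} (a : Fin n → Carrier) i → sum (λ k → a k * δ i k) ≈ a i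
  sum-δ a zero = trans (+-cong (*-identityʳ _) (sum-zero (λ i → zeroʳ (a (suc i))))) (+-identityʳ _)
  sum-δ a (suc i) = trans (+-cong (zeroʳ _) (sum-δ (a ∘ suc) i)) (+-identityˡ _)

  inverseˡ : ∀ x → ¬ x ≈ 0# → ∃ λ y → y * x ≈ 1#
  inverseˡ x x≉0 with y , xy≈1 ← inverse x x≉0 = y , trans (*-comm y x) xy≈1

  1≉0 : ¬ 1# ≈ 0#
  1≉0 = 0≉1 ∘ sym

  cons : ∀ {n} → Carrier → (Fin n → Carrier) → Fin (suc n) → Carrier
  cons a z zero    = a
  cons a z (suc i) = z i

  cons-linear : ∀ {n} → LinearMap (cons {n} 0#)
  cons-linear zero    = zero-linear
  cons-linear (suc i) = eval-linear i

  unit : ∀ {n} → Fin (suc n) → Carrier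
  unit = cons 1# 𝟘

  Functional : ℕ → Set (c ⊔ ℓ)
  Functional n = ∃ λ (φ : (Fin n → Carrier) → Carrier) → Linear φ

  data Pivot {n} : List (Functional (suc n)) → Set (c ⊔ ℓ) where
    none  : ∀ {φs} → All (λ φ → proj₁ φ unit ≈ 0#) φs → Pivot φs
    pivot : ∀ φs ψ χs → ¬ proj₁ ψ unit ≈ 0# → Pivot (φs ++ ψ ∷ χs)

  ¬¬-pivot : ∀ {n} (φs : List (Functional (suc n))) → ¬ ¬ Pivot φs
  ¬¬-pivot []       k = k (none [])
  ¬¬-pivot (φ ∷ φs) k = ¬¬-excluded-middle λ
    { (no ≉0)  → k (pivot [] φ φs ≉0)
    ; (yes ≈0) → ¬¬-pivot φs λ
        { (none all)          → k (none (≈0 ∷ all))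
        ; (pivot ψs ψ χs ≉0) → k (pivot (φ ∷ ψs) ψ χs ≉0)
        }
    }

  -- Gaussian elimination of the first coordinate. Only the search for a pivot needs case
  -- distinctions in the field, one for each functional inspected.
  kernel-nontrivial : ∀ {n} (φs : List (Functional n)) → length φs ℕ.< n →
    ¬ ¬ (∃ λ z → (∃ λ i → ¬ z i ≈ 0#) × All (λ φ → proj₁ φ z ≈ 0#) φs)
  kernel-nontrivial {suc n} φs len k = ¬¬-pivot φs (go len k)
    where
    go : ∀ {φs} → length φs ℕ.< suc n →
      ¬ (∃ λ z → (∃ λ i → ¬ z i ≈ 0#) × All (λ φ → proj₁ φ z ≈ 0#) φs) → ¬ Pivot φs
    go len k (none all) = k (unit , (zero , 1≉0) , all)
    go len k (pivot φs (ψ , Lψ) χs ≉0) = kernel-nontrivial (List.map reduce (φs ++ χs)) len′ λ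
      { (z , (i , zi≉0) , all) →
        -- The first coordinate is the one that solves the pivot equation for the given z.
        let z₀ = -1# * (ρ * ψ (cons 0# z))
            split : ∀ φ → Linear φ → φ (cons z₀ z) ≈ z₀ * φ unit + φ (cons 0# z)
            split φ Lφ = begin
              φ (cons z₀ z)                    ≈⟨ ≋-cong Lφ (λ
                { zero    → sym (trans (+-identityʳ _) (*-identityʳ _))
                ; (suc j) → sym (trans (+-congʳ (zeroʳ _)) (+-identityˡ _)) }) ⟩
              φ ((z₀ ⊙ unit) ⊕ cons 0# z)      ≈⟨ ⊕-homo Lφ _ _ ⟩
              φ (z₀ ⊙ unit) + φ (cons 0# z)    ≈⟨ +-congʳ (⊙-homo Lφ _ _) ⟩
              z₀ * φ unit + φ (cons 0# z)      ∎
            others : All (λ φ → proj₁ φ (cons z₀ z) ≈ 0#) (φs ++ χs)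
            others = All.map (λ { {φ , Lφ} e → trans (split φ Lφ) (trans
              (solve 5 (λ m r p u v → (m :* (r :* p)) :* u :+ v := v :+ (m :* (u :* r)) :* p) refl _ _ _ _ _) e) })
              (All.map⁻ all)
            at-ψ : ψ (cons z₀ z) ≈ 0#
            at-ψ = begin
              ψ (cons z₀ z)                                    ≈⟨ split ψ Lψ ⟩
              -1# * (ρ * ψ (cons 0# z)) * ψ unit + ψ (cons 0# z) ≈⟨ solve 4 (λ m r p u → (m :* (r :* p)) :* u :+ p := p :+ m :* ((r :* u) :* p)) refl _ _ _ _ ⟩
              ψ (cons 0# z) + -1# * (ρ * ψ unit * ψ (cons 0# z)) ≈⟨ +-congˡ (*-congˡ (trans (*-congʳ ρψ≈1) (*-identityˡ _))) ⟩
              ψ (cons 0# z) + -1# * ψ (cons 0# z)              ≈⟨ x+-1*x≈0 _ ⟩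
              0#                                               ∎
        in k (cons z₀ z , (suc i , zi≉0) ,
              All.++⁺ (All.++⁻ˡ φs others) (at-ψ ∷ All.++⁻ʳ φs others)) }
      where
      ρ = proj₁ (inverseˡ _ ≉0)
      ρψ≈1 = proj₂ (inverseˡ _ ≉0)
      -- Subtracts the multiple of ψ that agrees with φ on `unit`, so the first coordinate no longer
      -- matters.
      reduce : Functional (suc n) → Functional n
      reduce (φ , Lφ) = (λ z → φ (cons 0# z) + (-1# * (φ unit * ρ)) * ψ (cons 0# z)) ,
        +-linear (∘-linear Lφ cons-linear) (*-linear _ (∘-linear Lψ cons-linear))
      len′ : length (List.map reduce (φs ++ χs)) ℕ.< n
      len′ = ℕ.s<s⁻¹ (≡.subst (ℕ._< suc n) (≡.trans (List.length-++-sucʳ φs (ψ , Lψ) χs)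
        (≡.cong suc (≡.sym (List.length-map reduce (φs ++ χs))))) len)

  dot : ∀ {n} → (Fin n → Carrier) → (Fin n → Carrier) → Carrier
  dot v z = sum (λ j → v j * z j)

  dot-linear : ∀ {n} (v : Fin n → Carrier) → Linear (dot v)
  dot-linear v = sum-linear (λ j → *-linear (v j) (eval-linear j))

  dot-comm : ∀ {n} (v z : Fin n → Carrier) → dot v z ≈ dot z v
  dot-comm v z = sum-cong-≋ (λ j → *-comm (v j) (z j))

  -- Used with w a standard basis vector: the first case yields a row of the inverse of the matrix
  -- of directions, the second the normal of a hyperplane.
  span⊎separated : ∀ {m n} (v : Fin m → Fin n → Carrier) (w : Fin n → Carrier) →
    ¬ ¬ ((∃ λ (a : Fin m → Carrier) → w ≋ λ j → sum (λ i → a i * v i j)) ⊎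
         (∃ λ (z : Fin n → Carrier) → (∀ i → dot (v i) z ≈ 0#) × ¬ dot w z ≈ 0#))
  span⊎separated {zero} {n} v w k = ¬¬-all-zero w λ
    { (inj₁ w≈0)       → k (inj₁ ((λ ()) , w≈0))
    ; (inj₂ (j , ≉0)) → k (inj₂ (δ j , (λ ()) , λ e → ≉0 (trans (sym (sum-δ w j)) e)))
    }
    where
    ¬¬-all-zero : ∀ {n} (w : Fin n → Carrier) → ¬ ¬ (w ≋ 𝟘 ⊎ ∃ λ j → ¬ w j ≈ 0#)
    ¬¬-all-zero {zero}  w k = k (inj₁ (λ ()))
    ¬¬-all-zero {suc n} w k = ¬¬-excluded-middle λ
      { (no ≉0)  → k (inj₂ (zero , ≉0))
      ; (yes ≈0) → ¬¬-all-zero (w ∘ suc) λ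
          { (inj₁ all)      → k (inj₁ (λ { zero → ≈0 ; (suc j) → all j }))
          ; (inj₂ (j , ≉0)) → k (inj₂ (suc j , ≉0)) }
      }
  span⊎separated {suc m} v w k = span⊎separated (v ∘ suc) (v zero) λ
    { (inj₁ (a , v₀≋)) → span⊎separated (v ∘ suc) w λ
        { (inj₁ (b , w≋)) → k (inj₁ (cons 0# b , λ j →
            trans (w≋ j) (sym (trans (+-congʳ (zeroˡ _)) (+-identityˡ _)))))
        ; (inj₂ (z , z⊥ , ≉0)) → k (inj₂ (z , (λ
            { (suc i) → z⊥ i
            ; zero    → begin
                dot (v zero) z                               ≈⟨ dot-comm (v zero) z ⟩
                dot z (v zero)                               ≈⟨ ≋-cong (dot-linear z) v₀≋ ⟩
                dot z (λ j → sum (λ i → a i * v (suc i) j))  ≈⟨ sum-homo (dot-linear z) a (v ∘ suc) ⟩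
                sum (λ i → a i * dot z (v (suc i)))          ≈⟨ sum-zero (λ i →
                   trans (*-congˡ (trans (dot-comm z (v (suc i))) (z⊥ i))) (zeroʳ _)) ⟩
                0#                                           ∎ }) , ≉0))
        }
    ; (inj₂ (z , z⊥ , ≉0)) →
        let ρ , ρv≈1 = inverseˡ _ ≉0
            -- Chosen so that `w′` is orthogonal to z, the vector that separates `v zero` from the
            -- rest.
            b = dot w z * ρ
            w′ = w ⊕ (-1# * b) ⊙ v zero
            dot-w′ : ∀ y → dot w′ y ≈ dot w y + (-1# * b) * dot (v zero) y
            dot-w′ y = trans (dot-comm w′ y) (trans (⊕-homo (dot-linear y) w _)
              (+-cong (dot-comm y w) (trans (⊙-homo (dot-linear y) _ (v zero)) (*-congˡ (dot-comm y (v zero))))))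
        in span⊎separated (v ∘ suc) w′ λ
        { (inj₁ (a , w′≋)) → k (inj₁ (cons b a , λ j → begin
            w j                                              ≈⟨ +-identityʳ _ ⟨
            w j + 0#                                         ≈⟨ +-congˡ (x+-1*x≈0 _) ⟨
            w j + (b * v zero j + -1# * (b * v zero j))      ≈⟨ solve 4 (λ w b v m → w :+ (b :* v :+ m :* (b :* v)) := b :* v :+ (w :+ (m :* b) :* v)) refl _ _ _ _ ⟩
            b * v zero j + w′ j                              ≈⟨ +-congˡ (w′≋ j) ⟩
            b * v zero j + sum (λ i → a i * v (suc i) j)     ∎))
        ; (inj₂ (y , y⊥ , ≉0′)) →
            -- Correcting y along z makes it orthogonal to `v zero`, keeps it orthogonal to the
            -- others, and gives w the same product that `w′` has with y.
            let e = -1# * (dot (v zero) y * ρ)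
                dot-y′ : ∀ u → dot u (y ⊕ e ⊙ z) ≈ dot u y + e * dot u z
                dot-y′ u = trans (⊕-homo (dot-linear u) y _) (+-congˡ (⊙-homo (dot-linear u) e z))
            in k (inj₂ (y ⊕ e ⊙ z , (λ
            { zero → begin
                dot (v zero) (y ⊕ e ⊙ z)              ≈⟨ dot-y′ (v zero) ⟩
                dot (v zero) y + e * dot (v zero) z   ≈⟨ solve 4 (λ y m r z → y :+ (m :* (y :* r)) :* z := y :+ m :* (y :* (r :* z))) refl _ _ _ _ ⟩
                dot (v zero) y + -1# * (dot (v zero) y * (ρ * dot (v zero) z)) ≈⟨ +-congˡ (*-congˡ (trans (*-congˡ ρv≈1) (*-identityʳ _))) ⟩
                dot (v zero) y + -1# * dot (v zero) y ≈⟨ x+-1*x≈0 _ ⟩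
                0#                                    ∎
            ; (suc i) → trans (dot-y′ (v (suc i))) (trans (+-cong (y⊥ i) (trans (*-congˡ (z⊥ i)) (zeroʳ _))) (+-identityʳ 0#)) }) ,
            λ e≈0 → ≉0′ (begin
              dot w′ y                                        ≈⟨ dot-w′ y ⟩
              dot w y + (-1# * (dot w z * ρ)) * dot (v zero) y ≈⟨ solve 5 (λ y m z r v → y :+ (m :* (z :* r)) :* v := y :+ (m :* (v :* r)) :* z) refl _ _ _ _ _ ⟩
              dot w y + e * dot w z                           ≈⟨ dot-y′ w ⟨
              dot w (y ⊕ e ⊙ z)                               ≈⟨ e≈0 ⟩
              0#                                              ∎)))
        }
    }

-- Polynomials in several variables and affine substitutions.

module Polynomials {c ℓ} (F : Field c ℓ) where
  open LinearAlgebra F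
  open Field F hiding (zero)
  open import Algebra.Properties.Semiring.Sum semiring using (sum; sum-cong-≋; *-distribˡ-sum; *-distribʳ-sum)
  open import Algebra.Properties.CommutativeMonoid.Sum +-commutativeMonoid using (∑-distrib-+; ∑-comm)
  open import Algebra.Solver.Ring.NaturalCoefficients.Default commutativeSemiring
  open import Relation.Binary.Reasoning.Setoid setoid

  -- A polynomial in d variables is the function sending the exponent vector of a monomial to its coefficient.
  Series : ℕ → Set c
  Series d = Vec ℕ d → Carrier

  size : ∀ {d} → Vec ℕ d → ℕ
  size []      = 0
  size (k ∷ γ) = k ℕ.+ size γ

  one : ∀ {d} → Series d
  one []          = 1#
  one (zero  ∷ γ) = one γ
  one (suc _ ∷ γ) = 0#

  at0 : ∀ {d} → Series (suc d) → Series d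
  at0 h γ = h (0 ∷ γ)

  quot : ∀ {d} → Series (suc d) → Series (suc d)
  quot h (k ∷ γ) = h (suc k ∷ γ)

  embed : ∀ {d} → Series d → Series (suc d)
  embed h (zero  ∷ γ) = h γ
  embed h (suc _ ∷ γ) = 0#

  X : ∀ {d} → Fin d → Series d → Series d
  X zero    h (zero  ∷ γ) = 0#
  X zero    h (suc k ∷ γ) = h (k ∷ γ)
  X (suc j) h (k ∷ γ)     = X j (λ β → h (k ∷ β)) γ

  Affine : ℕ → Set c
  Affine d = Carrier × (Fin d → Carrier)

  mul : ∀ {d} → Affine d → Series d → Series d
  mul (a , b) h γ = a * h γ + sum (λ j → b j * X j h γ)

  -- The substitution of affine forms for the variables in the part of degree < n of h, by Horner's rule.
  subs : ∀ {d e} → ℕ → Series d → (Fin d → Affine e) → Series e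
  subs         zero    h A = 𝟘
  subs {zero}  (suc n) h A = h [] ⊙ one
  subs {suc d} (suc n) h A = subs (suc n) (at0 h) (A ∘ suc) ⊕ mul (A zero) (subs n (quot h) A)

  infixl 9 _⟨_⟩
  _⟨_⟩ : ∀ {d e} → Affine d → (Fin d → Affine e) → Affine e
  (a , b) ⟨ B ⟩ = a + sum (λ j → b j * proj₁ (B j)) , λ k → sum (λ j → b j * proj₂ (B j) k)

  at0-linear : ∀ {d} → LinearMap (at0 {d})
  at0-linear γ = eval-linear (0 ∷ γ)

  quot-linear : ∀ {d} → LinearMap (quot {d})
  quot-linear (k ∷ γ) = eval-linear (suc k ∷ γ)

  embed-linear : ∀ {d} → LinearMap (embed {d})
  embed-linear (zero  ∷ γ) = eval-linear γ
  embed-linear (suc _ ∷ γ) = zero-linear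

  X-linear : ∀ {d} (j : Fin d) → LinearMap (X j)
  X-linear zero    (zero  ∷ γ) = zero-linear
  X-linear zero    (suc k ∷ γ) = eval-linear (k ∷ γ)
  X-linear (suc j) (k ∷ γ)     = ∘-linear (X-linear j γ) (λ β → eval-linear (k ∷ β))

  mul-linear : ∀ {d} (A : Affine d) → LinearMap (mul A)
  mul-linear (a , b) γ =
    +-linear (*-linear a (eval-linear γ)) (sum-linear (λ j → *-linear (b j) (X-linear j γ)))

  subs-linear : ∀ {d e} n (A : Fin d → Affine e) → LinearMap (λ h → subs n h A)
  subs-linear         zero    A γ = zero-linear
  subs-linear {zero}  (suc n) A γ = record
    { ≋-cong = λ e → *-congʳ (e [])
    ; ⊕-homo = λ h k → distribʳ (one γ) (h []) (k [])
    ; ⊙-homo = λ a h → *-assoc a (h []) (one γ) }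
  subs-linear {suc d} (suc n) A γ = +-linear
    (∘-linear (subs-linear (suc n) (A ∘ suc) γ) at0-linear)
    (∘-linear (mul-linear (A zero) γ) (λ β → ∘-linear (subs-linear n A β) quot-linear))

  infix 4 _≈ᵃ_
  _≈ᵃ_ : ∀ {d} → Affine d → Affine d → Set ℓ
  (a , b) ≈ᵃ (a′ , b′) = a ≈ a′ × b ≋ b′

  mul-cong : ∀ {d} {A B : Affine d} {h k : Series d} → A ≈ᵃ B → h ≋ k → mul A h ≋ mul B k
  mul-cong (a≈ , b≋) h≋k γ = +-cong (*-cong a≈ (h≋k γ))
    (sum-cong-≋ (λ j → *-cong (b≋ j) (≋-cong (X-linear j γ) h≋k)))

  subs-congʳ : ∀ {d e} n (h : Series d) {A B : Fin d → Affine e} → (∀ j → A j ≈ᵃ B j) →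
    subs n h A ≋ subs n h B
  subs-congʳ         zero    h A≈B γ = refl
  subs-congʳ {zero}  (suc n) h A≈B γ = refl
  subs-congʳ {suc d} (suc n) h A≈B γ = +-cong (subs-congʳ (suc n) (at0 h) (A≈B ∘ suc) γ)
    (mul-cong (A≈B zero) (subs-congʳ n (quot h) A≈B) γ)

  X-comm : ∀ {d} (i j : Fin d) h → X i (X j h) ≋ X j (X i h)
  X-comm zero    zero    h γ           = refl
  X-comm zero    (suc j) h (zero  ∷ γ) = sym (𝟘-homo (X-linear j γ))
  X-comm zero    (suc j) h (suc k ∷ γ) = refl
  X-comm (suc i) zero    h (zero  ∷ γ) = 𝟘-homo (X-linear i γ)
  X-comm (suc i) zero    h (suc k ∷ γ) = refl
  X-comm (suc i) (suc j) h (k ∷ γ)     = X-comm i j (λ β → h (k ∷ β)) γ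

  X-mul-comm : ∀ {d} (i : Fin d) A h → X i (mul A h) ≋ mul A (X i h)
  X-mul-comm i (a , b) h γ = begin
    X i (mul (a , b) h) γ                                          ≈⟨ ⊕-homo (X-linear i γ) (a ⊙ h) _ ⟩
    X i (a ⊙ h) γ + X i (λ β → sum (λ j → b j * X j h β)) γ        ≈⟨ +-cong (⊙-homo (X-linear i γ) a h)
                                                                        (sum-homo (X-linear i γ) b (λ j → X j h)) ⟩
    a * X i h γ + sum (λ j → b j * X i (X j h) γ)                  ≈⟨ +-congˡ (sum-cong-≋ (λ j → *-congˡ (X-comm i j h γ))) ⟩
    mul (a , b) (X i h) γ                                          ∎

  linear-mul : ∀ {d} {φ : Series d → Carrier} → Linear φ → ∀ a b h →
    φ (mul (a , b) h) ≈ a * φ h + sum (λ j → b j * φ (X j h))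
  linear-mul Lφ a b h = trans (⊕-homo Lφ (a ⊙ h) _)
    (+-cong (⊙-homo Lφ a h) (sum-homo Lφ b (λ j → X j h)))

  mul-comm : ∀ {d} (A B : Affine d) h → mul A (mul B h) ≋ mul B (mul A h)
  mul-comm A@(a , b) B h γ = begin
    a * mul B h γ + sum (λ j → b j * X j (mul B h) γ)   ≈⟨ +-congˡ (sum-cong-≋ (λ j → *-congˡ (X-mul-comm j B h γ))) ⟩
    a * mul B h γ + sum (λ j → b j * mul B (X j h) γ)   ≈⟨ linear-mul (mul-linear B γ) a b h ⟨
    mul B (mul A h) γ                                   ∎

  mul-⟨⟩ : ∀ {d e} a b (B : Fin d → Affine e) h →
    mul ((a , b) ⟨ B ⟩) h ≋ λ γ → a * h γ + sum (λ j → b j * mul (B j) h γ)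
  mul-⟨⟩ {d} {e} a b B h γ = begin
    (a + sum (λ j → b j * proj₁ (B j))) * h γ + sum (λ k → sum (λ j → b j * proj₂ (B j) k) * X k h γ)
      ≈⟨ +-cong (distribʳ _ _ _) (sum-cong-≋ (λ k → *-distribʳ-sum (X k h γ) (λ j → b j * proj₂ (B j) k))) ⟩
    a * h γ + sum (λ j → b j * proj₁ (B j)) * h γ + sum (λ k → sum (λ j → b j * proj₂ (B j) k * X k h γ))
      ≈⟨ +-cong (+-congˡ (*-distribʳ-sum (h γ) (λ j → b j * proj₁ (B j)))) (∑-comm (λ k j → b j * proj₂ (B j) k * X k h γ)) ⟩
    a * h γ + sum (λ j → b j * proj₁ (B j) * h γ) + sum (λ j → sum (λ k → b j * proj₂ (B j) k * X k h γ))
      ≈⟨ +-assoc _ _ _ ⟩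
    a * h γ + (sum (λ j → b j * proj₁ (B j) * h γ) + sum (λ j → sum (λ k → b j * proj₂ (B j) k * X k h γ)))
      ≈⟨ +-congˡ (∑-distrib-+ {d} _ _) ⟨
    a * h γ + sum (λ j → b j * proj₁ (B j) * h γ + sum (λ k → b j * proj₂ (B j) k * X k h γ))
      ≈⟨ +-congˡ (sum-cong-≋ {d} (λ j → sym (trans (distribˡ _ _ _)
           (+-cong (sym (*-assoc _ _ _)) (trans (*-distribˡ-sum (b j) (λ k → proj₂ (B j) k * X k h γ))
             (sum-cong-≋ {e} (λ k → sym (*-assoc _ _ _)))))))) ⟩
    a * h γ + sum (λ j → b j * mul (B j) h γ) ∎

  -- A variable raises the degree by one, which is why the truncation is at `suc n` on one side and
  -- at n on the other.
  subs-X : ∀ {d e} n (j : Fin d) (h : Series d) (B : Fin d → Affine e) →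
    subs (suc n) (X j h) B ≋ mul (B j) (subs n h B)
  subs-X n zero h B γ = begin
    subs (suc n) 𝟘 (B ∘ suc) γ + mul (B zero) (subs n (quot (X zero h)) B) γ
      ≈⟨ +-cong (𝟘-homo (subs-linear (suc n) (B ∘ suc) γ))
           (≋-cong (mul-linear (B zero) γ) (λ β → ≋-cong (subs-linear n B β) (λ { (_ ∷ _) → refl }))) ⟩
    0# + mul (B zero) (subs n h B) γ
      ≈⟨ +-identityˡ _ ⟩
    mul (B zero) (subs n h B) γ ∎
  subs-X zero (suc j) h B γ = begin
    subs 1 (X j (at0 h)) (B ∘ suc) γ + mul (B zero) 𝟘 γ   ≈⟨ +-cong (subs-X 0 j (at0 h) (B ∘ suc) γ) (𝟘-homo (mul-linear (B zero) γ)) ⟩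
    mul (B (suc j)) 𝟘 γ + 0#                              ≈⟨ +-identityʳ _ ⟩
    mul (B (suc j)) 𝟘 γ                                   ∎
  subs-X (suc n) (suc j) h B γ = begin
    subs (suc (suc n)) (X j (at0 h)) (B ∘ suc) γ + mul (B zero) (subs (suc n) (quot (X (suc j) h)) B) γ
      ≈⟨ +-cong (subs-X (suc n) j (at0 h) (B ∘ suc) γ)
           (≋-cong (mul-linear (B zero) γ) (λ β → trans (≋-cong (subs-linear (suc n) B β) (λ { (_ ∷ _) → refl }))
             (subs-X n (suc j) (quot h) B β))) ⟩
    mul (B (suc j)) (subs (suc n) (at0 h) (B ∘ suc)) γ + mul (B zero) (mul (B (suc j)) (subs n (quot h) B)) γ
      ≈⟨ +-congˡ (mul-comm (B zero) (B (suc j)) _ γ) ⟩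
    mul (B (suc j)) (subs (suc n) (at0 h) (B ∘ suc)) γ + mul (B (suc j)) (mul (B zero) (subs n (quot h) B)) γ
      ≈⟨ ⊕-homo (mul-linear (B (suc j)) γ) _ _ ⟨
    mul (B (suc j)) (subs (suc n) h B) γ ∎

  Degree< : ∀ {d} → ℕ → Series d → Set ℓ
  Degree< n h = ∀ γ → n ℕ.≤ size γ → h γ ≈ 0#

  Order≥ : ∀ {d} → ℕ → Series d → Set ℓ
  Order≥ v h = ∀ γ → size γ ℕ.< v → h γ ≈ 0#

  degree-quot : ∀ {d n} {h : Series (suc d)} → Degree< (suc n) h → Degree< n (quot h)
  degree-quot deg (k ∷ γ) n≤ = deg (suc k ∷ γ) (s≤s n≤)

  subs-stable : ∀ {d e} n (h : Series d) (B : Fin d → Affine e) → Degree< n h →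
    subs (suc n) h B ≋ subs n h B
  subs-stable {zero}  zero    h B deg γ = trans (*-congʳ (deg [] z≤n)) (zeroˡ _)
  subs-stable {zero}  (suc n) h B deg γ = refl
  subs-stable {suc d} zero    h B deg γ = trans
    (+-cong (subs-stable 0 (at0 h) (B ∘ suc) (λ γ → deg (0 ∷ γ)) γ) (𝟘-homo (mul-linear (B zero) γ)))
    (+-identityʳ 0#)
  subs-stable {suc d} (suc n) h B deg γ = +-cong
    (subs-stable (suc n) (at0 h) (B ∘ suc) (λ γ → deg (0 ∷ γ)) γ)
    (≋-cong (mul-linear (B zero) γ) (subs-stable n (quot h) B (degree-quot deg)))

  subs-mul : ∀ {d e} n A (h : Series d) (B : Fin d → Affine e) → Degree< n h →
    subs (suc n) (mul A h) B ≋ mul (A ⟨ B ⟩) (subs n h B)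
  subs-mul n (a , b) h B deg γ = begin
    subs (suc n) (mul (a , b) h) B γ                                    ≈⟨ linear-mul (subs-linear (suc n) B γ) a b h ⟩
    a * subs (suc n) h B γ + sum (λ j → b j * subs (suc n) (X j h) B γ) ≈⟨ +-cong (*-congˡ (subs-stable n h B deg γ))
                                                                             (sum-cong-≋ (λ j → *-congˡ (subs-X n j h B γ))) ⟩
    a * subs n h B γ + sum (λ j → b j * mul (B j) (subs n h B) γ)       ≈⟨ mul-⟨⟩ a b B _ γ ⟨
    mul ((a , b) ⟨ B ⟩) (subs n h B) γ                                  ∎

  -- The alternative depends on γ alone and not on h; degree bounds and order bounds for `X` both
  -- follow from it.
  X-coefficient : ∀ {d} (j : Fin d) γ → (∀ h → X j h γ ≈ 0#) ⊎
    (∃ λ β → size γ ≡ suc (size β) × (∀ h → X j h γ ≈ h β))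
  X-coefficient zero    (zero  ∷ γ) = inj₁ (λ h → refl)
  X-coefficient zero    (suc k ∷ γ) = inj₂ (k ∷ γ , ≡.refl , λ h → refl)
  X-coefficient (suc j) (k ∷ γ) with X-coefficient j γ
  ... | inj₁ X≈0            = inj₁ (λ h → X≈0 (λ β → h (k ∷ β)))
  ... | inj₂ (β , eq , X≈h) = inj₂ (k ∷ β ,
    ≡.trans (≡.cong (k ℕ.+_) eq) (ℕ.+-suc k (size β)) , λ h → X≈h (λ β → h (k ∷ β)))

  degree-X : ∀ {d n} (j : Fin d) {h : Series d} → Degree< n h → Degree< (suc n) (X j h)
  degree-X j deg γ n<γ with X-coefficient j γ
  ... | inj₁ X≈0            = X≈0 _
  ... | inj₂ (β , eq , X≈h) = trans (X≈h _) (deg β (ℕ.s≤s⁻¹ (≡.subst (_ ℕ.≤_) eq n<γ)))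

  order-X : ∀ {d v} (j : Fin d) {h : Series d} → Order≥ v h → Order≥ (suc v) (X j h)
  order-X j ord γ γ<v with X-coefficient j γ
  ... | inj₁ X≈0            = X≈0 _
  ... | inj₂ (β , eq , X≈h) = trans (X≈h _) (ord β (ℕ.s<s⁻¹ (≡.subst (ℕ._< _) eq γ<v)))

  degree-mul : ∀ {d n} A {h : Series d} → Degree< n h → Degree< (suc n) (mul A h)
  degree-mul {n = n} (a , b) {h} deg γ n<γ = trans
    (+-cong (trans (*-congˡ (deg γ (ℕ.<⇒≤ n<γ))) (zeroʳ a))
            (sum-zero (λ j → trans (*-congˡ (degree-X {n = n} j {h} deg γ n<γ)) (zeroʳ (b j)))))
    (+-identityʳ 0#)

  degree-one : ∀ {d n} → Degree< (suc n) (one {d})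
  degree-one (zero  ∷ γ) n<γ = degree-one γ n<γ
  degree-one (suc _ ∷ γ) _   = refl

  degree-subs : ∀ {d e} n (h : Series d) (A : Fin d → Affine e) → Degree< n (subs n h A)
  degree-subs         zero    h A γ _   = refl
  degree-subs {zero}  (suc n) h A γ n≤γ = trans (*-congˡ (degree-one {n = n} γ n≤γ)) (zeroʳ _)
  degree-subs {suc d} (suc n) h A γ n≤γ = trans
    (+-cong (degree-subs (suc n) (at0 h) (A ∘ suc) γ n≤γ)
            (degree-mul (A zero) (degree-subs n (quot h) A) γ n≤γ))
    (+-identityʳ 0#)

  subs-one : ∀ {d e} n (B : Fin d → Affine e) → subs (suc n) one B ≋ one
  subs-one {zero}  n B γ = *-identityˡ _
  subs-one {suc d} n B γ = trans
    (+-cong (subs-one n (B ∘ suc) γ)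
      (trans (≋-cong (mul-linear (B zero) γ) (λ β → trans (≋-cong (subs-linear n B β) (λ { (_ ∷ _) → refl }))
                                                          (𝟘-homo (subs-linear n B β))))
             (𝟘-homo (mul-linear (B zero) γ))))
    (+-identityʳ _)

  -- Affine forms do not raise the degree, so the outer truncation at n removes nothing and no
  -- degree hypothesis on h is called for.
  subs-∘ : ∀ {d e f} n (h : Series d) (A : Fin d → Affine e) (B : Fin e → Affine f) →
    subs n (subs n h A) B ≋ subs n h (λ j → A j ⟨ B ⟩)
  subs-∘         zero    h A B γ = refl
  subs-∘ {zero}  (suc n) h A B γ = trans (⊙-homo (subs-linear (suc n) B γ) (h []) one)
    (*-congˡ (subs-one n B γ))
  subs-∘ {suc d} (suc n) h A B γ = trans (⊕-homo (subs-linear (suc n) B γ) _ _) (+-cong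
    (subs-∘ (suc n) (at0 h) (A ∘ suc) B γ)
    (trans (subs-mul n (A zero) _ B (degree-subs n (quot h) A) γ)
      (≋-cong (mul-linear (A zero ⟨ B ⟩) γ) (subs-∘ n (quot h) A B))))

  variableᵃ : ∀ {d} → Fin d → Affine d
  variableᵃ i = 0# , δ i

  mul-variable : ∀ {d} (i : Fin d) h → mul (variableᵃ i) h ≋ X i h
  mul-variable {d} i h γ = trans (+-cong (zeroˡ _)
    (trans (sum-cong-≋ {d} (λ j → *-comm _ _)) (sum-δ (λ j → X j h γ) i))) (+-identityˡ _)

  weakenᵃ : ∀ {d} → Affine d → Affine (suc d)
  weakenᵃ (a , b) = a , cons 0# b

  X-embed : ∀ {d} (j : Fin d) h → X (suc j) (embed h) ≋ embed (X j h)
  X-embed j h (zero  ∷ γ) = refl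
  X-embed j h (suc k ∷ γ) = 𝟘-homo (X-linear j γ)

  mul-embed : ∀ {d} A (h : Series d) → mul (weakenᵃ A) (embed h) ≋ embed (mul A h)
  mul-embed (a , b) h γ = trans
    (+-congˡ (trans (+-congʳ (zeroˡ _)) (trans (+-identityˡ _) (sum-cong-≋ (λ j → *-congˡ (X-embed j h γ))))))
    (sym (linear-mul′ γ))
    where
    linear-mul′ : ∀ γ → embed (mul (a , b) h) γ ≈ a * embed h γ + sum (λ j → b j * embed (X j h) γ)
    linear-mul′ γ = linear-mul (embed-linear γ) a b h

  embed-one : ∀ {d} → embed (one {d}) ≋ one
  embed-one (zero  ∷ γ) = refl
  embed-one (suc k ∷ γ) = refl

  subs-weaken : ∀ {d e} n (h : Series d) (A : Fin d → Affine e) →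
    subs n h (weakenᵃ ∘ A) ≋ embed (subs n h A)
  subs-weaken         zero    h A γ = sym (𝟘-homo (embed-linear γ))
  subs-weaken {zero}  (suc n) h A γ = trans (*-congˡ (sym (embed-one γ)))
    (sym (⊙-homo (embed-linear γ) (h []) one))
  subs-weaken {suc d} (suc n) h A γ = trans
    (+-cong (subs-weaken (suc n) (at0 h) (A ∘ suc) γ)
      (trans (≋-cong (mul-linear (weakenᵃ (A zero)) γ) (subs-weaken n (quot h) A))
             (mul-embed (A zero) (subs n (quot h) A) γ)))
    (sym (⊕-homo (embed-linear γ) _ _))

  -- Induction on d: the forms for the later variables are weakened ones, and h is `at0 h` plus the
  -- first variable times `quot h`.
  subs-variable : ∀ {d} n (h : Series d) → Degree< n h → subs n h variableᵃ ≋ h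
  subs-variable         zero    h deg γ = sym (deg γ z≤n)
  subs-variable {zero}  (suc n) h deg [] = *-identityʳ _
  subs-variable {suc d} (suc n) h deg γ = trans
    (+-cong
      (trans (subs-congʳ (suc n) (at0 h) (λ j → refl , λ { zero → refl ; (suc k) → refl }) γ)
        (trans (subs-weaken (suc n) (at0 h) variableᵃ γ)
          (≋-cong (embed-linear γ) (subs-variable (suc n) (at0 h) (λ β → deg (0 ∷ β))))))
      (trans (mul-variable zero _ γ)
        (≋-cong (X-linear zero γ) (subs-variable n (quot h) (degree-quot deg)))))
    (assemble γ)
    where
    assemble : ∀ γ → embed (at0 h) γ + X zero (quot h) γ ≈ h γ
    assemble (zero  ∷ γ) = +-identityʳ _
    assemble (suc k ∷ γ) = +-identityˡ _

  -- Substitution respects every such filtration; the order at the origin and the divisibility of slices are instances.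
  record Filtration {d e} (A : Fin d → Affine e) : Set (Level.suc (c ⊔ ℓ)) where
    field
      Fil     : ℕ → Series e → Set (c ⊔ ℓ)
      resp    : ∀ {v h k} → h ≋ k → Fil v h → Fil v k
      fil-𝟘   : ∀ {v} → Fil v 𝟘
      fil-⊕   : ∀ {v h k} → Fil v h → Fil v k → Fil v (h ⊕ k)
      fil-one : ∀ a → Fil 0 (a ⊙ one)
      raise   : ∀ {v h} j → Fil v h → Fil (suc v) (mul (A j) h)
      lower   : ∀ {v h} → Fil (suc v) h → Fil v h

  restrict : ∀ {d e} {A : Fin (suc d) → Affine e} → Filtration A → Filtration (A ∘ suc)
  restrict Φ = record
    { Fil = Fil ; resp = resp ; fil-𝟘 = fil-𝟘 ; fil-⊕ = fil-⊕ ; fil-one = fil-one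
    ; raise = λ j → raise (suc j) ; lower = lower }
    where open Filtration Φ

  subs-filtered : ∀ {d e} {A : Fin d → Affine e} (Φ : Filtration A) → ∀ n {v} {h : Series d} →
    Order≥ v h → Filtration.Fil Φ v (subs n h A)
  subs-filtered Φ zero ord = Filtration.fil-𝟘 Φ
  subs-filtered {zero} Φ (suc n) {zero}  ord = Filtration.fil-one Φ _
  subs-filtered {zero} Φ (suc n) {suc v} ord = resp (λ γ → sym (trans (*-congʳ (ord [] (s≤s z≤n))) (zeroˡ _))) fil-𝟘
    where open Filtration Φ
  subs-filtered {suc d} {A = A} Φ (suc n) {v} {h} ord =
    fil-⊕ (subs-filtered (restrict Φ) (suc n) (λ γ → ord (0 ∷ γ))) (second v ord)
    where
    open Filtration Φ
    second : ∀ v → Order≥ v h → Fil v (mul (A zero) (subs n (quot h) A))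
    -- Order at least 0 says nothing, so the factor gained from `A zero` is given away again.
    second zero    ord = lower (raise zero (subs-filtered Φ n {0} (λ _ ())))
    second (suc v) ord = raise zero (subs-filtered Φ n (λ { (k ∷ γ) γ<v → ord (suc k ∷ γ) (s≤s γ<v) }))

  order-mul : ∀ {d v} {a} {b : Fin d → Carrier} {h : Series d} → a ≈ 0# → Order≥ v h → Order≥ (suc v) (mul (a , b) h)
  order-mul {v = v} {b = b} {h} a≈0 ord γ γ<v = trans
    (+-cong (trans (*-congʳ a≈0) (zeroˡ _))
            (sum-zero (λ j → trans (*-congˡ (order-X {v = v} j {h} ord γ γ<v)) (zeroʳ (b j)))))
    (+-identityʳ 0#)

  order-filtration : ∀ {d e} {A : Fin d → Affine e} → (∀ j → proj₁ (A j) ≈ 0#) → Filtration A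
  order-filtration A₀≈0 = record
    { Fil     = λ v h → Level.Lift c (Order≥ v h)
    ; resp    = λ h≋k (Level.lift o) → Level.lift (λ γ γ< → trans (sym (h≋k γ)) (o γ γ<))
    ; fil-𝟘   = Level.lift (λ _ _ → refl)
    ; fil-⊕   = λ (Level.lift o) (Level.lift p) →
                  Level.lift (λ γ γ< → trans (+-cong (o γ γ<) (p γ γ<)) (+-identityʳ 0#))
    ; fil-one = λ _ → Level.lift (λ _ ())
    ; raise   = λ { {v} {h} j (Level.lift o) → Level.lift (order-mul {v = v} {h = h} (A₀≈0 j) o) }
    ; lower   = λ (Level.lift o) → Level.lift (λ γ γ< → o γ (ℕ.m<n⇒m<1+n γ<))
    }

  order-subs : ∀ {d e} n {v} {h : Series d} {A : Fin d → Affine e} →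
    (∀ j → proj₁ (A j) ≈ 0#) → Order≥ v h → Order≥ v (subs n h A)
  order-subs n A₀≈0 ord = Level.lower (subs-filtered (order-filtration A₀≈0) n ord)

-- Univariate polynomials and the bound on their roots.

module Roots {c ℓ} (F : Field c ℓ) where
  open LinearAlgebra F
  open Field F hiding (zero)
  open import Algebra.Solver.Ring.NaturalCoefficients.Default commutativeSemiring
  open import Relation.Binary.Reasoning.Setoid setoid

  Seq : Set c
  Seq = ℕ → Carrier

  -- multiplication of univariate polynomials by s + r
  times : Carrier → Seq → Seq
  times r u zero    = r * u zero
  times r u (suc k) = u k + r * u (suc k)

  VanishesFrom : ℕ → Seq → Set ℓ
  VanishesFrom n u = ∀ k → n ℕ.≤ k → u k ≈ 0#

  Finite : Seq → Set ℓ
  Finite u = ∃ λ n → VanishesFrom n u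

  -- The last quotient must be finite: among power series, s + r with r ≠ 0 is a unit and would
  -- divide everything.
  Divisible : Carrier → ℕ → Seq → Set (c ⊔ ℓ)
  Divisible r zero    u = Level.Lift c (Finite u)
  Divisible r (suc m) u = ∃ λ w → Divisible r m w × u ≋ times r w

  times-linear : ∀ r → LinearMap (times r)
  times-linear r zero    = *-linear r (eval-linear zero)
  times-linear r (suc k) = +-linear (eval-linear k) (*-linear r (eval-linear (suc k)))

  times-comm : ∀ r r′ u → times r (times r′ u) ≋ times r′ (times r u)
  times-comm r r′ u zero          = solve 3 (λ r s a → r :* (s :* a) := s :* (r :* a)) refl _ _ _
  times-comm r r′ u (suc zero)    = solve 4 (λ r s a b → s :* a :+ r :* (a :+ s :* b) := r :* a :+ s :* (a :+ r :* b)) refl _ _ _ _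
  times-comm r r′ u (suc (suc k)) = solve 5 (λ r s a b d → (a :+ s :* b) :+ r :* (b :+ s :* d) := (a :+ r :* b) :+ s :* (b :+ r :* d)) refl _ _ _ _ _

  finite-resp : ∀ {u w} → u ≋ w → Finite u → Finite w
  finite-resp u≋w (n , v) = n , λ k n≤k → trans (sym (u≋w k)) (v k n≤k)

  finite-⊕ : ∀ {u w} → Finite u → Finite w → Finite (u ⊕ w)
  finite-⊕ (m , v) (n , v′) = m ℕ.⊔ n , λ k m⊔n≤k → trans
    (+-cong (v k (ℕ.m⊔n≤o⇒m≤o m n m⊔n≤k)) (v′ k (ℕ.m⊔n≤o⇒n≤o m n m⊔n≤k))) (+-identityʳ 0#)

  finite-⊙ : ∀ a {u} → Finite u → Finite (a ⊙ u)
  finite-⊙ a (n , v) = n , λ k n≤k → trans (*-congˡ (v k n≤k)) (zeroʳ a)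

  finite-times : ∀ r {u} → Finite u → Finite (times r u)
  finite-times r (n , v) = suc n , λ { (suc k) (s≤s n≤k) → trans
    (+-cong (v k n≤k) (trans (*-congˡ (v (suc k) (ℕ.m≤n⇒m≤1+n n≤k))) (zeroʳ r))) (+-identityʳ 0#) }

  divisible-resp : ∀ {r} m {u w} → u ≋ w → Divisible r m u → Divisible r m w
  divisible-resp zero    u≋w (Level.lift fin) = Level.lift (finite-resp u≋w fin)
  divisible-resp (suc m) u≋w (q , div , eq) = q , div , λ k → trans (sym (u≋w k)) (eq k)

  divisible-finite : ∀ {r} m {u} → Divisible r m u → Finite u
  divisible-finite zero    (Level.lift fin) = fin
  divisible-finite (suc m) (q , div , eq) =
    finite-resp (λ k → sym (eq k)) (finite-times _ (divisible-finite m div))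

  divisible-𝟘 : ∀ {r} m → Divisible r m 𝟘
  divisible-𝟘 zero    = Level.lift (0 , λ _ _ → refl)
  divisible-𝟘 (suc m) = 𝟘 , divisible-𝟘 m , λ k → sym (𝟘-homo (times-linear _ k))

  divisible-⊕ : ∀ {r} m {u w} → Divisible r m u → Divisible r m w → Divisible r m (u ⊕ w)
  divisible-⊕ zero    (Level.lift fin) (Level.lift fin′) = Level.lift (finite-⊕ fin fin′)
  divisible-⊕ (suc m) (q , div , eq) (q′ , div′ , eq′) = q ⊕ q′ , divisible-⊕ m div div′ ,
    λ k → trans (+-cong (eq k) (eq′ k)) (sym (⊕-homo (times-linear _ k) q q′))

  divisible-⊙ : ∀ {r} m a {u} → Divisible r m u → Divisible r m (a ⊙ u)
  divisible-⊙ zero    a (Level.lift fin) = Level.lift (finite-⊙ a fin)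
  divisible-⊙ (suc m) a (q , div , eq) = a ⊙ q , divisible-⊙ m a div ,
    λ k → trans (*-congˡ (eq k)) (sym (⊙-homo (times-linear _ k) a q))

  divisible-pred : ∀ {r} m {u} → Divisible r (suc m) u → Divisible r m u
  divisible-pred zero    div = Level.lift (divisible-finite 1 div)
  divisible-pred (suc m) (q , div , eq) = q , divisible-pred m div , eq

  divisible-≤ : ∀ {r m n u} → m ℕ.≤ n → Divisible r n u → Divisible r m u
  divisible-≤ {r} {m} {n} {u} m≤n = go (ℕ.≤⇒≤′ m≤n)
    where
    go : ∀ {n} → m ℕ.≤′ n → Divisible r n u → Divisible r m u
    go (ℕ.≤′-reflexive ≡.refl) div = div
    go (ℕ.≤′-step m≤n)         div = go m≤n (divisible-pred _ div)

  -- Since s + r is monic, the quotient has smaller degree. Its coefficients are cleared downwards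
  -- from the bound m supplied by finiteness, j being the distance left.
  times-vanishesFrom : ∀ {r n w} → Finite w → VanishesFrom n (times r w) → VanishesFrom (pred n) w
  times-vanishesFrom {r} {n} {w} (m , fin) v k n≤k = descend m k (ℕ.m≤m+n m k) n≤k
    where
    descend : ∀ j k → m ℕ.≤ j ℕ.+ k → pred n ℕ.≤ k → w k ≈ 0#
    descend zero    k m≤   n≤k = fin k m≤
    descend (suc j) k m≤   n≤k = begin
      w k                    ≈⟨ +-identityʳ _ ⟨
      w k + 0#               ≈⟨ +-congˡ (trans (*-congˡ (descend j (suc k)
                                   (≡.subst (m ℕ.≤_) (≡.sym (ℕ.+-suc j k)) m≤) (ℕ.m≤n⇒m≤1+n n≤k))) (zeroʳ r)) ⟨
      times r w (suc k)      ≈⟨ v (suc k) (ℕ.≤-trans (ℕ.m≤n+m∸n n 1) (s≤s n≤k)) ⟩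
      0#                     ∎

  times-injective : ∀ {r u w} → Finite u → Finite w → times r u ≋ times r w → u ≋ w
  times-injective {r} {u} {w} fin fin′ eq k = begin
    u k                              ≈⟨ +-identityʳ _ ⟨
    u k + 0#                         ≈⟨ +-congˡ (x+-1*x≈0 (w k)) ⟨
    u k + (w k + -1# * w k)          ≈⟨ solve 3 (λ u w d → u :+ (w :+ d) := w :+ (u :+ d)) refl _ _ _ ⟩
    w k + (u k + -1# * w k)          ≈⟨ +-congˡ (times-vanishesFrom {n = 0} (finite-⊕ fin (finite-⊙ -1# fin′)) zero-diff k z≤n) ⟩
    w k + 0#                         ≈⟨ +-identityʳ _ ⟩
    w k                              ∎
    where
    zero-diff : VanishesFrom 0 (times r (u ⊕ -1# ⊙ w))
    zero-diff k _ = begin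
      times r (u ⊕ -1# ⊙ w) k               ≈⟨ ⊕-homo (times-linear r k) u (-1# ⊙ w) ⟩
      times r u k + times r (-1# ⊙ w) k     ≈⟨ +-cong (eq k) (⊙-homo (times-linear r k) -1# w) ⟩
      times r w k + -1# * times r w k       ≈⟨ x+-1*x≈0 _ ⟩
      0#                                    ∎

  -- (s + r) − (s + r′) is a unit, which gives a Bézout identity for the two linear factors.
  divisible-cancel : ∀ {r r′} → ¬ r ≈ r′ → ∀ m {u} → Finite u → Divisible r′ m (times r u) → Divisible r′ m u
  divisible-cancel r≉r′ zero fin _ = Level.lift fin
  divisible-cancel {r} {r′} r≉r′ (suc m) {u} fin (w , div , eq) =
    q , divisible-cancel r≉r′ m fin-q (divisible-resp m (λ k → sym (rq≋w k)) div) , u≋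
    where
    r-r′≉0 : ¬ r + -1# * r′ ≈ 0#
    r-r′≉0 e = r≉r′ (begin
      r                       ≈⟨ +-identityʳ _ ⟨
      r + 0#                  ≈⟨ +-congˡ (x+-1*x≈0 r′) ⟨
      r + (r′ + -1# * r′)     ≈⟨ solve 3 (λ u w d → u :+ (w :+ d) := w :+ (u :+ d)) refl _ _ _ ⟩
      r′ + (r + -1# * r′)     ≈⟨ +-congˡ e ⟩
      r′ + 0#                 ≈⟨ +-identityʳ _ ⟩
      r′                      ∎)
    e = proj₁ (inverseˡ _ r-r′≉0)
    e-inv = proj₂ (inverseˡ _ r-r′≉0)
    -- From (r - r′)u = (s + r)u - (s + r′)u = (s + r′)(w - u), with e the inverse of r - r′.
    q : Seq
    q = e ⊙ (w ⊕ -1# ⊙ u)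
    fin-q : Finite q
    fin-q = finite-⊙ e (finite-⊕ (divisible-finite m div) (finite-⊙ -1# fin))
    difference : ∀ k → times r u k + -1# * times r′ u k ≈ (r + -1# * r′) * u k
    difference zero    = solve 4 (λ r s n a → r :* a :+ n :* (s :* a) := (r :+ n :* s) :* a) refl _ _ _ _
    difference (suc k) = begin
      (u k + r * u (suc k)) + -1# * (u k + r′ * u (suc k))
        ≈⟨ solve 5 (λ r s n a b → (a :+ r :* b) :+ n :* (a :+ s :* b) := (a :+ n :* a) :+ (r :+ n :* s) :* b) refl _ _ _ _ _ ⟩
      (u k + -1# * u k) + (r + -1# * r′) * u (suc k)   ≈⟨ +-congʳ (x+-1*x≈0 _) ⟩
      0# + (r + -1# * r′) * u (suc k)                  ≈⟨ +-identityˡ _ ⟩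
      (r + -1# * r′) * u (suc k)                       ∎
    u≋ : u ≋ times r′ q
    u≋ k = begin
      u k                                              ≈⟨ *-identityˡ _ ⟨
      1# * u k                                         ≈⟨ *-congʳ e-inv ⟨
      e * (r + -1# * r′) * u k                         ≈⟨ *-assoc _ _ _ ⟩
      e * ((r + -1# * r′) * u k)                       ≈⟨ *-congˡ (difference k) ⟨
      e * (times r u k + -1# * times r′ u k)           ≈⟨ *-congˡ (+-cong (eq k) (sym (⊙-homo (times-linear r′ k) -1# u))) ⟩
      e * (times r′ w k + times r′ (-1# ⊙ u) k)        ≈⟨ *-congˡ (sym (⊕-homo (times-linear r′ k) w (-1# ⊙ u))) ⟩
      e * times r′ (w ⊕ -1# ⊙ u) k                     ≈⟨ ⊙-homo (times-linear r′ k) e _ ⟨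
      times r′ q k                                     ∎
    rq≋w : times r q ≋ w
    rq≋w = times-injective (finite-times r fin-q) (divisible-finite m div) (λ k → begin
      times r′ (times r q) k   ≈⟨ times-comm r′ r q k ⟩
      times r (times r′ q) k   ≈⟨ ≋-cong (times-linear r k) u≋ ⟨
      times r u k              ≈⟨ eq k ⟩
      times r′ w k             ∎)

  -- Linear factors are stripped one at a time, each lowering the degree bound and the remaining
  -- multiplicity by one. Distinctness is asked only of roots of positive multiplicity, so joints
  -- off the line may carry a dummy root.
  roots-bound : ∀ {N} (r : Fin N → Carrier) (m : Fin N → ℕ) →
    (∀ p q → p ≢ q → 0 ℕ.< m p → 0 ℕ.< m q → ¬ r p ≈ r q) →
    ∀ {n u} → VanishesFrom n u → (∀ p → Divisible (r p) (m p) u) → n ℕ.≤ ∑ m → u ≋ 𝟘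
  roots-bound {zero}  r m distinct van div n≤ k = van k (ℕ.≤-trans n≤ z≤n)
  roots-bound {suc N} r m distinct {n} van div n≤ =
    peel (m zero) (div zero) van (div ∘ suc) n≤
      (λ p → distinct zero (suc p) (λ ()))
    where
    peel : ∀ m₀ {n u} → Divisible (r zero) m₀ u → VanishesFrom n u →
      (∀ p → Divisible (r (suc p)) (m (suc p)) u) → n ℕ.≤ m₀ ℕ.+ ∑ (m ∘ suc) →
      (∀ p → 0 ℕ.< m₀ → 0 ℕ.< m (suc p) → ¬ r zero ≈ r (suc p)) → u ≋ 𝟘
    peel zero div₀ van div n≤ _ = roots-bound (r ∘ suc) (m ∘ suc)
      (λ p q p≢q → distinct (suc p) (suc q) (p≢q ∘ Fin.suc-injective)) van div n≤
    peel (suc m₀) {n} {u} (w , div₀ , u≋) van div n≤ d k = trans (u≋ k)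
      (trans (≋-cong (times-linear (r zero) k) w≋𝟘) (𝟘-homo (times-linear (r zero) k)))
      where
      fin = divisible-finite m₀ div₀
      others : ∀ p → Divisible (r (suc p)) (m (suc p)) w
      others p with m (suc p) | div p | d p (s≤s z≤n)
      ... | zero  | _    | _  = Level.lift fin
      ... | suc k | divp | d′ = divisible-cancel (d′ (s≤s z≤n)) (suc k) fin (divisible-resp (suc k) u≋ divp)
      w≋𝟘 : w ≋ 𝟘
      w≋𝟘 = peel m₀ div₀ (times-vanishesFrom fin (λ k n≤k → trans (sym (u≋ k)) (van k n≤k)))
        others (ℕ.pred-mono-≤ n≤) (λ p _ → d p (s≤s z≤n))

-- Coordinates on polynomials of bounded degree, and restriction to one variable.

module Slices {c ℓ} (F : Field c ℓ) where
  open LinearAlgebra F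
  open Polynomials F
  open Roots F
  open Field F hiding (zero)
  open import Algebra.Properties.Semiring.Sum semiring using (sum; sum-cong-≋; *-distribʳ-sum)
  open import Algebra.Properties.CommutativeMonoid.Sum +-commutativeMonoid using (∑-distrib-+)
  open import Algebra.Solver.Ring.NaturalCoefficients.Default commutativeSemiring
  open import Relation.Binary.Reasoning.Setoid setoid

  fromCoefficients : ∀ d n → (Fin (dimension d n) → Carrier) → Series d
  fromCoefficients d       zero    z γ  = 0#
  fromCoefficients zero    (suc n) z [] = z zero
  fromCoefficients (suc d) (suc n) z (zero  ∷ γ) = fromCoefficients d (suc n) (z ∘ (_↑ˡ dimension (suc d) n)) γ
  fromCoefficients (suc d) (suc n) z (suc k ∷ γ) = fromCoefficients (suc d) n (z ∘ (dimension d (suc n) ↑ʳ_)) (k ∷ γ)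

  fromCoefficients-linear : ∀ d n → LinearMap (fromCoefficients d n)
  fromCoefficients-linear d       zero    γ  = zero-linear
  fromCoefficients-linear zero    (suc n) [] = eval-linear zero
  fromCoefficients-linear (suc d) (suc n) (zero  ∷ γ) =
    ∘-linear (fromCoefficients-linear d (suc n) γ) (λ j → eval-linear _)
  fromCoefficients-linear (suc d) (suc n) (suc k ∷ γ) =
    ∘-linear (fromCoefficients-linear (suc d) n (k ∷ γ)) (λ j → eval-linear _)

  fromCoefficients-degree : ∀ d n z → Degree< n (fromCoefficients d n z)
  fromCoefficients-degree d       zero    z γ  _ = refl
  fromCoefficients-degree (suc d) (suc n) z (zero  ∷ γ) n≤ = fromCoefficients-degree d (suc n) _ γ n≤
  fromCoefficients-degree (suc d) (suc n) z (suc k ∷ γ) (s≤s n≤) = fromCoefficients-degree (suc d) n _ (k ∷ γ) n≤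

  fromCoefficients-injective : ∀ d n z → fromCoefficients d n z ≋ 𝟘 → z ≋ 𝟘
  fromCoefficients-injective zero    (suc n) z h≋𝟘 zero = h≋𝟘 []
  fromCoefficients-injective (suc d) (suc n) z h≋𝟘 i =
    ≡.subst (λ i → z i ≈ 0#) (Fin.join-splitAt (dimension d (suc n)) _ i) (case (splitAt (dimension d (suc n)) i))
    where
    case : ∀ s → z (join (dimension d (suc n)) (dimension (suc d) n) s) ≈ 0#
    case (inj₁ i) = fromCoefficients-injective d (suc n) _ (λ γ → h≋𝟘 (0 ∷ γ)) i
    case (inj₂ i) = fromCoefficients-injective (suc d) n _ (λ { (k ∷ γ) → h≋𝟘 (suc k ∷ γ) }) i

  δ-refl : ∀ {n} (i : Fin n) → δ i i ≈ 1#
  δ-refl zero    = refl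
  δ-refl (suc i) = δ-refl i

  δ-≢ : ∀ {n} {i j : Fin n} → i ≢ j → δ i j ≈ 0#
  δ-≢ {i = zero}  {zero}  i≢j = contradiction ≡.refl i≢j
  δ-≢ {i = zero}  {suc j} i≢j = refl
  δ-≢ {i = suc i} {zero}  i≢j = refl
  δ-≢ {i = suc i} {suc j} i≢j = δ-≢ (i≢j ∘ ≡.cong suc)

  cosize : ∀ {d} → Fin d → Vec ℕ d → ℕ
  cosize i γ = size (γ [ i ]≔ 0)

  slice : ∀ {d} → Fin d → Vec ℕ d → Series d → Seq
  slice i γ h k = h (γ [ i ]≔ k)

  size-update : ∀ {d} i (γ : Vec ℕ d) k → size (γ [ i ]≔ k) ≡ k ℕ.+ cosize i γ
  size-update zero    (m ∷ γ) k = ≡.refl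
  size-update (suc i) (m ∷ γ) k = ≡.trans (≡.cong (m ℕ.+_) (size-update i γ k))
    (≡.trans (≡.sym (ℕ.+-assoc m k _)) (≡.trans (≡.cong (ℕ._+ cosize i γ) (ℕ.+-comm m k)) (ℕ.+-assoc k m _)))

  slice-X-≢ : ∀ {d} {i j : Fin d} → i ≢ j → ∀ γ → (∀ h k → slice i γ (X j h) k ≈ 0#) ⊎
    (∃ λ β → cosize i γ ≡ suc (cosize i β) × (∀ h k → slice i γ (X j h) k ≈ slice i β h k))
  slice-X-≢ {i = zero}  {zero}  i≢j γ = contradiction ≡.refl i≢j
  slice-X-≢ {i = zero}  {suc j} i≢j (m ∷ γ) with X-coefficient j γ
  ... | inj₁ X≈0            = inj₁ (λ h k → X≈0 _)
  -- The entry at the sliced position is overwritten, so 0 is as good as any.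
  ... | inj₂ (β , eq , X≈h) = inj₂ (0 ∷ β , eq , λ h k → X≈h _)
  slice-X-≢ {i = suc i} {zero}  i≢j (zero  ∷ γ) = inj₁ (λ h k → refl)
  slice-X-≢ {i = suc i} {zero}  i≢j (suc m ∷ γ) = inj₂ (m ∷ γ , ≡.refl , λ h k → refl)
  slice-X-≢ {i = suc i} {suc j} i≢j (m ∷ γ) with slice-X-≢ {i = i} {j} (i≢j ∘ ≡.cong suc) γ
  ... | inj₁ X≈0            = inj₁ (λ h → X≈0 (λ β → h (m ∷ β)))
  ... | inj₂ (β , eq , X≈h) = inj₂ (m ∷ β ,
    ≡.trans (≡.cong (m ℕ.+_) eq) (ℕ.+-suc m _) , λ h → X≈h (λ β → h (m ∷ β)))

  slice-X-zero : ∀ {d} (i : Fin d) γ h → slice i γ (X i h) zero ≈ 0#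
  slice-X-zero zero    (m ∷ γ) h = refl
  slice-X-zero (suc i) (m ∷ γ) h = slice-X-zero i γ (λ β → h (m ∷ β))

  slice-X-suc : ∀ {d} (i : Fin d) γ h k → slice i γ (X i h) (suc k) ≈ slice i γ h k
  slice-X-suc zero    (m ∷ γ) h k = refl
  slice-X-suc (suc i) (m ∷ γ) h k = slice-X-suc i γ (λ β → h (m ∷ β)) k

  slice-times : ∀ {d} (i : Fin d) γ r h → slice i γ (X i h ⊕ r ⊙ h) ≋ times r (slice i γ h)
  slice-times i γ r h zero    = trans (+-congʳ (slice-X-zero i γ h)) (+-identityˡ _)
  slice-times i γ r h (suc k) = +-congʳ (slice-X-suc i γ h k)

  divisible-sum : ∀ {n r} m (b : Fin n → Carrier) {u : Fin n → Seq} → (∀ j → Divisible r m (u j)) →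
    Divisible r m (λ k → sum (λ j → b j * u j k))
  divisible-sum {zero}  m b div = divisible-𝟘 m
  divisible-sum {suc n} m b div =
    divisible-⊕ m (divisible-⊙ m (b zero) (div zero)) (divisible-sum m (b ∘ suc) (div ∘ suc))

  slice-finite : ∀ {d n} (i : Fin d) γ {h : Series d} → Degree< n h → VanishesFrom n (slice i γ h)
  slice-finite {n = n} i γ deg k n≤k = deg _ (ℕ.≤-trans n≤k
    (ℕ.≤-trans (ℕ.m≤m+n k (cosize i γ)) (ℕ.≤-reflexive (≡.sym (size-update i γ k)))))

  -- SlicesDivisible v contains the v-th power of the ideal generated by y_i + r and the y_j with j ≠ i.
  module _ {d} (i : Fin d) (r : Carrier) where

    SlicesDivisible : ℕ → Series d → Set (c ⊔ ℓ)
    SlicesDivisible v h = ∀ γ → Divisible r (v ℕ.∸ cosize i γ) (slice i γ h)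

    -- The form is b_i (y_i + r) plus multiples of the other y_j. The first part adds a factor s + r
    -- to each slice; a y_j with j ≠ i shifts to a slice whose `cosize` is one less, which is
    -- allowed one more factor.
    raise-slices : ∀ {v a b h} → a ≈ r * b i → SlicesDivisible v h → SlicesDivisible (suc v) (mul (a , b) h)
    raise-slices {v} {a} {b} {h} a≈rb div γ = divisible-resp (suc v ℕ.∸ cosize i γ) (λ k → sym (expand (γ [ i ]≔ k)))
      (divisible-sum (suc v ℕ.∸ cosize i γ) b factor)
      where
      expand : ∀ γ → mul (a , b) h γ ≈ sum (λ j → b j * (X j h γ + r * δ i j * h γ))
      expand γ = begin
        a * h γ + sum (λ j → b j * X j h γ)
          ≈⟨ +-congʳ (*-congʳ (trans a≈rb (*-congˡ (sym (sum-δ b i))))) ⟩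
        r * sum (λ j → b j * δ i j) * h γ + sum (λ j → b j * X j h γ)
          ≈⟨ +-congʳ (trans (*-assoc _ _ _) (trans (*-comm _ _) (trans (*-assoc _ _ _) (*-distribʳ-sum (h γ * r) (λ j → b j * δ i j))))) ⟩
        sum (λ j → b j * δ i j * (h γ * r)) + sum (λ j → b j * X j h γ)
          ≈⟨ ∑-distrib-+ {d} _ _ ⟨
        sum (λ j → b j * δ i j * (h γ * r) + b j * X j h γ)
          ≈⟨ sum-cong-≋ {d} (λ j → solve 5 (λ b e h r x → b :* e :* (h :* r) :+ b :* x := b :* (x :+ r :* e :* h)) refl (b j) (δ i j) (h γ) r (X j h γ)) ⟩
        sum (λ j → b j * (X j h γ + r * δ i j * h γ)) ∎
      factor : ∀ j → Divisible r (suc v ℕ.∸ cosize i γ) (slice i γ (X j h ⊕ (r * δ i j) ⊙ h))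
      factor j with i Fin.≟ j
      ... | yes ≡.refl = divisible-≤ (ℕ.m≤n+o⇒m∸n≤o (suc v) (cosize i γ) bound)
        (divisible-resp (suc (v ℕ.∸ cosize i γ))
          (λ k → trans (sym (slice-times i γ r h k)) (+-congˡ (*-congʳ (sym (trans (*-congˡ (δ-refl i)) (*-identityʳ r))))))
          (slice i γ h , div γ , λ k → refl))
        where
        bound : suc v ℕ.≤ cosize i γ ℕ.+ suc (v ℕ.∸ cosize i γ)
        bound = ≡.subst (suc v ℕ.≤_) (≡.sym (ℕ.+-suc _ _)) (s≤s (ℕ.m≤n+m∸n v (cosize i γ)))
      ... | no i≢j = divisible-resp _ (λ k → sym (trans (+-congˡ (trans (*-congʳ (trans (*-congˡ (δ-≢ i≢j)) (zeroʳ r))) (zeroˡ _))) (+-identityʳ _))) other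
        where
        other : Divisible r (suc v ℕ.∸ cosize i γ) (slice i γ (X j h))
        other with slice-X-≢ i≢j γ
        ... | inj₁ X≈0            = divisible-resp _ (λ k → sym (X≈0 h k)) (divisible-𝟘 (suc v ℕ.∸ cosize i γ))
        ... | inj₂ (β , eq , X≈h) rewrite eq = divisible-resp _ (λ k → sym (X≈h h k)) (div β)

    -- The condition says that all forms vanish at -r times the i-th unit vector: the substitution
    -- sends that point to the origin.
    slices-filtration : ∀ {e} {A : Fin e → Affine d} → (∀ j → proj₁ (A j) ≈ r * proj₂ (A j) i) → Filtration A
    slices-filtration A₀≈ = record
      { Fil     = SlicesDivisible
      ; resp    = λ h≋k div γ → divisible-resp _ (λ k → h≋k _) (div γ)
      ; fil-𝟘   = λ γ → divisible-𝟘 _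
      ; fil-⊕   = λ div div′ γ → divisible-⊕ _ (div γ) (div′ γ)
      ; fil-one = λ a γ → ≡.subst (λ m → Divisible r m (slice i γ (a ⊙ one))) (≡.sym (ℕ.0∸n≡0 (cosize i γ)))
          (Level.lift (1 , slice-finite i γ (λ β 1≤ → trans (*-congˡ (degree-one {n = 0} β 1≤)) (zeroʳ a))))
      ; raise   = λ j → raise-slices (A₀≈ j)
      ; lower   = λ {v} div γ → divisible-≤ (ℕ.∸-monoˡ-≤ (cosize i γ) (ℕ.n≤1+n v)) (div γ)
      }

box : ∀ {d} → (Fin d → ℕ) → List (Vec ℕ d)
box {zero}  B = [] ∷ []
box {suc d} B = cartesianProductWith _∷_ (upTo (B zero)) (box (B ∘ suc))

length-cartesianProductWith : ∀ {a b c} {A : Set a} {B : Set b} {C : Set c} (f : A → B → C) xs ys →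
  length (cartesianProductWith f xs ys) ≡ length xs ℕ.* length ys
length-cartesianProductWith f []       ys = ≡.refl
length-cartesianProductWith f (x ∷ xs) ys = ≡.trans (List.length-++ (List.map (f x) ys))
  (≡.cong₂ ℕ._+_ (List.length-map (f x) ys) (length-cartesianProductWith f xs ys))

length-box : ∀ {d} (B : Fin d → ℕ) → length (box B) ≡ ∏ B
length-box {zero}  B = ≡.refl
length-box {suc d} B = ≡.trans (length-cartesianProductWith _∷_ (upTo (B zero)) (box (B ∘ suc)))
  (≡.cong₂ ℕ._*_ (List.length-upTo (B zero)) (length-box (B ∘ suc)))

∈-box : ∀ {d} (B : Fin d → ℕ) γ → (∀ i → lookup γ i ℕ.< B i) → γ ∈ box B
∈-box {zero}  B []      γ<B = here ≡.refl
∈-box {suc d} B (k ∷ γ) γ<B =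
  ∈-cartesianProductWith⁺ _∷_ (∈-upTo⁺ (γ<B zero)) (∈-box (B ∘ suc) γ (γ<B ∘ suc))

length-concat-tabulate : ∀ {a} {A : Set a} {n} (f : Fin n → List A) →
  length (concat (tabulate f)) ≡ ∑ (length ∘ f)
length-concat-tabulate {n = zero}  f = ≡.refl
length-concat-tabulate {n = suc n} f =
  ≡.trans (List.length-++ (f zero)) (≡.cong (length (f zero) ℕ.+_) (length-concat-tabulate (f ∘ suc)))

-- Vanishing at joints and the dimension inequality.

module Multijoints {c ℓ} (F : Field c ℓ) where
  open LinearAlgebra F
  open Polynomials F
  open Roots F
  open Slices F
  open Field F hiding (zero)
  open import Algebra.Properties.Semiring.Sum semiring using (sum; sum-cong-≋)
  open import Algebra.Properties.Ring ring using (+-cancelʳ)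
  open import Algebra.Solver.Ring.NaturalCoefficients.Default commutativeSemiring
  open import Relation.Binary.Reasoning.Setoid setoid

  -- N points; the i-th line through p has direction dir p i and is the line number (lab p i) of the i-th family.
  record Configuration (d N : ℕ) (m : Fin d → ℕ) : Set (c ⊔ ℓ) where
    field
      point     : Fin N → Fin d → Carrier
      dir       : Fin N → Fin d → Fin d → Carrier
      codir     : Fin N → Fin d → Fin d → Carrier
      lab       : Fin N → ∀ i → Fin (m i)
      dual      : ∀ p j k → sum (λ l → codir p k l * dir p l j) ≈ δ k j
      collinear : ∀ p q i → lab p i ≡ lab q i → ∃ λ t → ∀ j → point p j ≈ point q j + t * dir p i j
      distinct  : ∀ p q → p ≢ q → ¬ point p ≋ point q

  δ-sym : ∀ {n} (i j : Fin n) → δ i j ≈ δ j i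
  δ-sym zero    zero    = refl
  δ-sym zero    (suc j) = refl
  δ-sym (suc i) zero    = refl
  δ-sym (suc i) (suc j) = δ-sym i j

  sum-δˡ : ∀ {n} (a : Fin n → Carrier) i → sum (λ k → δ i k * a k) ≈ a i
  sum-δˡ {n} a i = trans (sum-cong-≋ {n} (λ k → *-comm (δ i k) (a k))) (sum-δ a i)

  module Vanishing {d N m} (J : Configuration d N m) where
    open Configuration J

    -- Coordinates at p parallel to the standard axes, and coordinates along the lines through p.
    -- Orders are recorded in the former, box conditions in the latter; `codir` gives the way back.
    center frame : Fin N → Fin d → Affine d
    center p j = point p j , δ j
    frame  p j = point p j , λ k → dir p k j

    toFrame : Fin N → Fin N → Fin d → Affine d
    toFrame p q j = point p j + -1# * point q j , λ k → dir p k j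

    fromFrame : Fin N → Fin d → Affine d
    fromFrame p l = 0# , λ k → codir p k l

    fromCenter : Fin N → Fin d → Affine d
    fromCenter p j = -1# * point p j , δ j

    center-toFrame : ∀ p q j → center q j ⟨ toFrame p q ⟩ ≈ᵃ frame p j
    center-toFrame p q j = trans (+-congˡ (sum-δˡ _ j)) (trans
        (solve 3 (λ q p w → q :+ (p :+ w) := p :+ (q :+ w)) refl _ _ _)
        (trans (+-congˡ (x+-1*x≈0 _)) (+-identityʳ _))) ,
      λ k → sum-δˡ (λ l → dir p k l) j

    frame-fromFrame : ∀ p j → frame p j ⟨ fromFrame p ⟩ ≈ᵃ center p j
    frame-fromFrame p j = trans (+-congˡ (sum-zero (λ l → zeroʳ (dir p l j)))) (+-identityʳ _) ,
      λ k → trans (sum-cong-≋ {d} (λ l → *-comm _ _)) (trans (dual p j k) (δ-sym k j))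

    center-fromCenter : ∀ p j → center p j ⟨ fromCenter p ⟩ ≈ᵃ variableᵃ j
    center-fromCenter p j = trans (+-congˡ (sum-δˡ _ j)) (x+-1*x≈0 _) ,
      λ k → sum-δˡ (λ l → δ l k) j

    module _ (n : ℕ) (g : Series d) where

      O T : Fin N → Series d
      O p = subs n g (center p)
      T p = subs n g (frame p)

      O⇒T : ∀ p q → subs n (O q) (toFrame p q) ≋ T p
      O⇒T p q γ = trans (subs-∘ n g (center q) (toFrame p q) γ) (subs-congʳ n g (center-toFrame p q) γ)

      T⇒O : ∀ p → subs n (T p) (fromFrame p) ≋ O p
      T⇒O p γ = trans (subs-∘ n g (frame p) (fromFrame p) γ) (subs-congʳ n g (frame-fromFrame p) γ)

      order-resp : ∀ {w} {h k : Series d} → h ≋ k → Order≥ w h → Order≥ w k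
      order-resp h≋k ord γ γ< = trans (sym (h≋k γ)) (ord γ γ<)

      order-O⇒T : ∀ p {w} → Order≥ w (O p) → Order≥ w (T p)
      order-O⇒T p {w} ord = order-resp {w} (O⇒T p p) (order-subs n {w} (λ j → x+-1*x≈0 _) ord)

      order-T⇒O : ∀ p {w} → Order≥ w (T p) → Order≥ w (O p)
      order-T⇒O p {w} ord = order-resp {w} (T⇒O p) (order-subs n {w} (λ j → refl) ord)

      O-injective : ∀ p → Degree< n g → O p ≋ 𝟘 → g ≋ 𝟘
      O-injective p deg O≋𝟘 γ = begin
        g γ                          ≈⟨ subs-variable n g deg γ ⟨
        subs n g variableᵃ γ         ≈⟨ subs-congʳ n g (center-fromCenter p) γ ⟨
        subs n g (λ j → center p j ⟨ fromCenter p ⟩) γ ≈⟨ subs-∘ n g (center p) (fromCenter p) γ ⟨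
        subs n (O p) (fromCenter p) γ ≈⟨ ≋-cong (subs-linear n (fromCenter p) γ) O≋𝟘 ⟩
        subs n 𝟘 (fromCenter p) γ    ≈⟨ 𝟘-homo (subs-linear n (fromCenter p) γ) ⟩
        0#                           ∎

      -- In the frame of p, the joint q sits at -t on the i-th axis. The exponents of the other
      -- variables use up `cosize i γ` of the order at q.
      slice-divisible : ∀ p q i t {w} → (∀ j → point p j ≈ point q j + t * dir p i j) → Order≥ w (O q) →
        ∀ γ → Divisible t (w ℕ.∸ cosize i γ) (slice i γ (T p))
      slice-divisible p q i t {w} p≈ ord γ = divisible-resp _ (λ k → O⇒T p q _)
        (subs-filtered (slices-filtration i t shift) n {w} ord γ)
        where
        shift : ∀ j → point p j + -1# * point q j ≈ t * dir p i j
        shift j = begin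
          point p j + -1# * point q j                    ≈⟨ +-congʳ (p≈ j) ⟩
          point q j + t * dir p i j + -1# * point q j    ≈⟨ solve 3 (λ q t w → q :+ t :+ w := t :+ (q :+ w)) refl _ _ _ ⟩
          t * dir p i j + (point q j + -1# * point q j)  ≈⟨ +-congˡ (x+-1*x≈0 _) ⟩
          t * dir p i j + 0#                             ≈⟨ +-identityʳ _ ⟩
          t * dir p i j                                  ∎

      -- Gives every joint a root, also off the line, where its multiplicity is 0; `roots-bound`
      -- then runs over all joints at once.
      record Root (p : Fin N) (i : Fin d) (u : Seq) (b : ℕ) (q : Fin N) : Set (c ⊔ ℓ) where
        field
          root mult : _
          divides   : Divisible root mult u
          enough    : b ℕ.≤ mult
          on-line   : 0 ℕ.< mult → ∀ j → point p j ≈ point q j + root * dir p i j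

      slice-zero : ∀ p i γ (w lower : Fin N → ℕ) → Degree< n g →
        (∀ q → lab p i ≡ lab q i → Order≥ (w q) (O q)) →
        (∀ q → lab p i ≡ lab q i → lower q ℕ.≤ w q ℕ.∸ cosize i γ) →
        n ℕ.≤ ∑ (λ q → lower q when (lab p i Fin.≟ lab q i)) →
        slice i γ (T p) ≋ 𝟘
      slice-zero p i γ w lower deg ord lower≤ n≤ =
        roots-bound (λ q → root (r q)) (λ q → mult (r q)) roots-distinct
          (slice-finite i γ (degree-subs n g (frame p))) (λ q → divides (r q))
          (ℕ.≤-trans n≤ (∑-mono (λ q → enough (r q))))
        where
        open Root
        r : ∀ q → Root p i (slice i γ (T p)) (lower q when (lab p i Fin.≟ lab q i)) q
        r q with lab p i Fin.≟ lab q i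
        ... | yes eq = let t , p≈ = collinear p q i eq in record
          { root    = t
          ; mult    = w q ℕ.∸ cosize i γ
          ; divides = slice-divisible p q i t {w q} p≈ (ord q eq) γ
          ; enough  = lower≤ q eq
          ; on-line = λ _ → p≈ }
        ... | no _ = record
          { root    = 0#
          ; mult    = 0
          ; divides = Level.lift (n , slice-finite i γ (degree-subs n g (frame p)))
          ; enough  = z≤n
          ; on-line = λ () }
        roots-distinct : ∀ q q′ → q ≢ q′ → 0 ℕ.< mult (r q) → 0 ℕ.< mult (r q′) → ¬ root (r q) ≈ root (r q′)
        roots-distinct q q′ q≢q′ m>0 m′>0 eq = distinct q q′ q≢q′ (λ j →
          +-cancelʳ (root (r q) * dir p i j) _ _ (begin
            point q j + root (r q) * dir p i j    ≈⟨ on-line (r q) m>0 j ⟨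
            point p j                             ≈⟨ on-line (r q′) m′>0 j ⟩
            point q′ j + root (r q′) * dir p i j  ≈⟨ +-congˡ (*-congʳ eq) ⟨
            point q′ j + root (r q) * dir p i j   ∎))

    module _ {n : ℕ} (x : Fin N → ℕ) (level : Fin N → Fin d → ℕ) {k} {K : Fin N → Set k}
      (closed : ∀ {p q} i → K p → lab p i ≡ lab q i → K q)
      (big : ∀ {p} → K p → ∀ i → n ℕ.≤ ∑ (λ q → (level p i ℕ.∸ x q) when (lab p i Fin.≟ lab q i)))
      where

      VanishesOnBox : Series d → Fin N → Set ℓ
      VanishesOnBox g p = ∀ γ → (∀ i → lookup γ i ℕ.< level p i ℕ.∸ x p) → T n g p γ ≈ 0#

      -- The induction is simultaneous over K: the order at p rises by means of the previous orders
      -- at all joints on one of its lines, and these lie in K by `closed`.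
      order-increases : ∀ {g} → Degree< n g → (∀ {p} → K p → VanishesOnBox g p) →
        ∀ τ {p} → K p → Order≥ (τ ℕ.∸ x p) (O n g p)
      order-increases deg van zero {p} Kp γ γ< = contradiction (≡.subst (size γ ℕ.<_) (ℕ.0∸n≡0 (x p)) γ<) λ ()
      order-increases {g} deg van (suc τ) {p} Kp = order-T⇒O n g p coefficient
        where
        ord : ∀ {q} → K q → Order≥ (τ ℕ.∸ x q) (O n g q)
        ord = order-increases deg van τ
        coefficient : Order≥ (suc τ ℕ.∸ x p) (T n g p)
        coefficient γ γ< with size γ ℕ.<? τ ℕ.∸ x p
        ... | yes γ<′ = order-O⇒T n g p {τ ℕ.∸ x p} (ord Kp) γ γ<′
        ... | no γ≮ with Fin.all? (λ i → lookup γ i ℕ.<? level p i ℕ.∸ x p)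
        ...   | yes inside = van Kp γ inside
        -- The exponent leaves the box in direction i, so the whole slice through γ in that
        -- direction is shown to vanish, and with it the coefficient at γ.
        ...   | no outside with i , γᵢ≮ ← Fin.¬∀⟶∃¬ d _ (λ i → lookup γ i ℕ.<? level p i ℕ.∸ x p) outside =
          ≡.subst (λ β → T n g p β ≈ 0#) (Vec.[]≔-lookup γ i)
            (slice-zero n g p i γ (λ q → τ ℕ.∸ x q) (λ q → level p i ℕ.∸ x q) deg
              (λ q eq → ord (closed i Kp eq)) (λ q _ → lower≤ q) (big Kp i) (lookup γ i))
          where
          e = cosize i γ
          size-γ : size γ ≡ lookup γ i ℕ.+ e
          size-γ = ≡.trans (≡.cong size (≡.sym (Vec.[]≔-lookup γ i))) (size-update i γ (lookup γ i))
          x≤τ : x p ℕ.≤ τ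
          x≤τ with x p ℕ.≤? τ
          ... | yes le = le
          ... | no x≰τ = contradiction (≡.subst (size γ ℕ.<_) (ℕ.m≤n⇒m∸n≡0 (ℕ.≰⇒> x≰τ)) γ<) λ ()
          size≡ : size γ ≡ τ ℕ.∸ x p
          size≡ = ℕ.≤-antisym (ℕ.s≤s⁻¹ (≡.subst (size γ ℕ.<_) (ℕ.+-∸-assoc 1 x≤τ) γ<)) (ℕ.≮⇒≥ γ≮)
          τ≡ : τ ≡ lookup γ i ℕ.+ e ℕ.+ x p
          τ≡ = ≡.trans (≡.sym (ℕ.m∸n+n≡m x≤τ)) (≡.cong (ℕ._+ x p) (≡.trans (≡.sym size≡) size-γ))
          -- Leaving the box means level ≤ x p + γ_i, while τ = γ_i + e + x p. Hence τ ∸ x q ∸ e is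
          -- at least level ∸ x q at every q, as `big` requires.
          level≤ : level p i ℕ.≤ τ ℕ.∸ e
          level≤ = ℕ.m+n≤o⇒m≤o∸n (level p i) (≡.subst (level p i ℕ.+ e ℕ.≤_) (≡.trans rearrange (≡.sym τ≡))
            (ℕ.+-monoˡ-≤ e (ℕ.≤-trans (ℕ.m≤n+m∸n (level p i) (x p)) (ℕ.+-monoʳ-≤ (x p) (ℕ.≮⇒≥ γᵢ≮)))))
            where
            rearrange : x p ℕ.+ lookup γ i ℕ.+ e ≡ lookup γ i ℕ.+ e ℕ.+ x p
            rearrange = ≡.trans (ℕ.+-assoc (x p) _ e) (ℕ.+-comm (x p) _)
          lower≤ : ∀ q → level p i ℕ.∸ x q ℕ.≤ τ ℕ.∸ x q ℕ.∸ e
          lower≤ q = ℕ.≤-trans (ℕ.∸-monoˡ-≤ (x q) level≤) (ℕ.≤-reflexive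
            (≡.trans (ℕ.∸-+-assoc τ e (x q)) (≡.trans (≡.cong (τ ℕ.∸_) (ℕ.+-comm e (x q))) (≡.sym (ℕ.∸-+-assoc τ (x q) e)))))

      vanishing : ∀ {g} → Degree< n g → (∀ {p} → K p → VanishesOnBox g p) → ∃ K → g ≋ 𝟘
      vanishing {g} deg van (p , Kp) = O-injective n g p deg zero-series
        where
        zero-series : O n g p ≋ 𝟘
        zero-series γ with size γ ℕ.<? n
        -- At τ = n + x p the order reaches n, the degree bound.
        ... | yes γ<n = order-increases deg van (n ℕ.+ x p) Kp γ (≡.subst (size γ ℕ.<_) (≡.sym (ℕ.m+n∸n≡m n (x p))) γ<n)
        ... | no γ≮n  = degree-subs n g (center p) γ (ℕ.≮⇒≥ γ≮n)

      -- Counting of parameters: with fewer box conditions than coefficients, a nonzero polynomial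
      -- would satisfy all of them. The goal being a contradiction, the double negation in
      -- `kernel-nontrivial` costs nothing.
      dimension-bound : (K? : Decidable K) → ∃ K →
        dimension d n ℕ.≤ ∑ (λ p → ∏ (λ i → level p i ℕ.∸ x p) when K? p)
      dimension-bound K? Kne = ℕ.≮⇒≥ λ total< →
        kernel-nontrivial (concat (tabulate conditions)) (≡.subst (ℕ._< dimension d n) (≡.sym total) total<)
          λ { (z , (i , zᵢ≉0) , all) → zᵢ≉0 (fromCoefficients-injective d n z
                (vanishing (fromCoefficients-degree d n z) (λ {p} Kp γ inside →
                   satisfied z p (All.tabulate⁻ (All.concat⁻ all) p) Kp γ inside) Kne) i) }
        where
        B : Fin N → Fin d → ℕ
        B p i = level p i ℕ.∸ x p
        coefficient : Fin N → Vec ℕ d → Functional (dimension d n)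
        coefficient p γ = (λ z → T n (fromCoefficients d n z) p γ) ,
          ∘-linear (subs-linear n (frame p) γ) (fromCoefficients-linear d n)
        conditions : Fin N → List (Functional (dimension d n))
        conditions p with K? p
        ... | yes _ = List.map (coefficient p) (box (B p))
        ... | no  _ = []
        length-conditions : ∀ p → length (conditions p) ≡ ∏ (B p) when K? p
        length-conditions p with K? p
        ... | yes _ = ≡.trans (List.length-map (coefficient p) (box (B p))) (length-box (B p))
        ... | no  _ = ≡.refl
        total : length (concat (tabulate conditions)) ≡ ∑ (λ p → ∏ (B p) when K? p)
        total = ≡.trans (length-concat-tabulate conditions) (∑-cong length-conditions)
        satisfied : ∀ z p → All (λ φ → proj₁ φ z ≈ 0#) (conditions p) → K p → VanishesOnBox (fromCoefficients d n z) p
        satisfied z p all Kp γ inside with K? p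
        ... | yes _  = All.lookup (All.map⁻ all) (∈-box (B p) γ inside)
        ... | no ¬Kp = contradiction Kp ¬Kp

-- From lists of lines and points to configurations, and the limit n → ∞.

¬¬-∀ : ∀ {a n} {P : Fin n → Set a} → (∀ i → ¬ ¬ P i) → ¬ ¬ (∀ i → P i)
¬¬-∀ = Fin.sequence (RawMonad.rawApplicative ¬¬-Monad)

AllPairs-lookup : ∀ {a r} {A : Set a} {R : Rel A r} → Symmetric R → ∀ {xs} → AllPairs R xs →
  ∀ p q → p ≢ q → R (List.lookup xs p) (List.lookup xs q)
AllPairs-lookup sym (_ ∷ _)   zero    zero    p≢q = contradiction ≡.refl p≢q
AllPairs-lookup sym (x∼ ∷ _)  zero    (suc q) p≢q = All.lookup x∼ (∈-lookup q)
AllPairs-lookup sym (x∼ ∷ _)  (suc p) zero    p≢q = sym (All.lookup x∼ (∈-lookup p))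
AllPairs-lookup sym (_ ∷ xs∼) (suc p) (suc q) p≢q = AllPairs-lookup sym xs∼ p q (p≢q ∘ ≡.cong suc)

product-tabulate : ∀ {n} (f : Fin n → ℕ) → product (tabulate f) ≡ ∏ f
product-tabulate {zero}  f = ≡.refl
product-tabulate {suc n} f = ≡.cong (f zero ℕ.*_) (product-tabulate (f ∘ suc))

open import Data.Nat using (ℕ; _≤_; _^_; _∸_; _*_; _!)

module _ {c ℓ} (F : Field c ℓ) where
  open LinearAlgebra F
  open Multijoints F

  module _ (d : ℕ) where
    open Field F hiding (zero) renaming (_*_ to _·_)
    open Geometry F d
    open import Algebra.Properties.Semiring.Sum semiring using (sum)
    open import Algebra.Solver.Ring.NaturalCoefficients.Default commutativeSemiring
    open import Relation.Binary.Reasoning.Setoid setoid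

    sumFin≡sum : ∀ n (f : Fin n → Carrier) → sumFin n f ≡ sum f
    sumFin≡sum zero    f = ≡.refl
    sumFin≡sum (suc n) f = ≡.cong (f zero +_) (sumFin≡sum n (f ∘ suc))

    onLine-difference : ∀ {x y} l → OnLine x l → OnLine y l → ∃ λ t → ∀ j → x j ≈ y j + t · Line.dir l j
    onLine-difference {x} {y} (line b v _) (s , x≈) (t , y≈) = s + -1# · t , λ j → begin
      x j                                        ≈⟨ x≈ j ⟩
      b j + s · v j                              ≈⟨ +-identityʳ _ ⟨
      b j + s · v j + 0#                         ≈⟨ +-congˡ (x+-1*x≈0 (t · v j)) ⟨
      b j + s · v j + (t · v j + -1# · (t · v j)) ≈⟨ solve 5 (λ b s v t n → b :+ s :* v :+ (t :* v :+ n :* (t :* v)) := b :+ t :* v :+ (s :+ n :* t) :* v) refl _ _ _ _ _ ⟩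
      b j + t · v j + (s + -1# · t) · v j        ≈⟨ +-congʳ (y≈ j) ⟨
      y j + (s + -1# · t) · v j                  ∎

    -- A vector orthogonal to all directions would be the normal of a hyperplane containing the lines.
    transversal : ∀ {x} (l : Fin d → Line) → (∀ i → OnLine x (l i)) →
      ¬ (∃ λ H → ∀ i → LineInHyperplane (l i) H) →
      ¬ ¬ (∃ λ (C : Fin d → Fin d → Carrier) → ∀ j k → sum (λ i → C k i · Line.dir (l i) j) ≈ δ k j)
    transversal {x} l on ¬H = ¬¬-map (λ inv → proj₁ ∘ inv , λ j k → sym (proj₂ (inv k) j)) (¬¬-∀ coordinates)
      where
      coordinates : ∀ k → ¬ ¬ (∃ λ (a : Fin d → Carrier) → δ k ≋ λ j → sum (λ i → a i · Line.dir (l i) j))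
      coordinates k outside = span⊎separated (Line.dir ∘ l) (δ k) λ
        { (inj₁ inside) → outside inside
        ; (inj₂ (z , z⊥ , ≉0)) → ¬H
            ( hyperplane z (sumFin d (λ i → z i · x i))
                (λ z≈0 → ≉0 (trans (≋-cong (dot-linear (δ k)) z≈0) (𝟘-homo (dot-linear (δ k)))))
            , λ i y y∈l → let t , y≈ = onLine-difference (l i) y∈l (on i) in begin
                sumFin d (λ j → z j · y j)               ≡⟨ sumFin≡sum d _ ⟩
                dot z y                                  ≈⟨ ≋-cong (dot-linear z) y≈ ⟩
                dot z (x ⊕ t ⊙ Line.dir (l i))           ≈⟨ ⊕-homo (dot-linear z) x _ ⟩
                dot z x + dot z (t ⊙ Line.dir (l i))     ≈⟨ +-congˡ (⊙-homo (dot-linear z) t _) ⟩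
                dot z x + t · dot z (Line.dir (l i))     ≈⟨ +-congˡ (*-congˡ (trans (dot-comm z (Line.dir (l i))) (z⊥ i))) ⟩
                dot z x + t · 0#                         ≈⟨ +-congˡ (zeroʳ t) ⟩
                dot z x + 0#                             ≈⟨ +-identityʳ _ ⟩
                dot z x                                  ≡⟨ sumFin≡sum d _ ⟨
                sumFin d (λ i → z i · x i)               ∎ )
        }

    configuration : (L : Fin d → List Line) (J : List Point) → DistinctPoints J → All (IsJoint L) J →
      ¬ ¬ Configuration d (length J) (length ∘ L)
    configuration L J distinct joints = ¬¬-map build (¬¬-∀ λ p → transversal (through p) (on p) (proj₂ (proj₂ (proj₂ (joint p)))))
      where
      joint : ∀ p → IsJoint L (List.lookup J p)
      joint p = All.lookup joints (∈-lookup p)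
      through : Fin (length J) → Fin d → Line
      through p i = List.lookup (L i) (proj₁ (joint p) i)
      on : ∀ p i → OnLine (List.lookup J p) (through p i)
      on p = proj₁ (proj₂ (joint p))
      build : (∀ p → ∃ λ (C : Fin d → Fin d → Carrier) → ∀ j k → sum (λ i → C k i · Line.dir (through p i) j) ≈ δ k j) →
        Configuration d (length J) (length ∘ L)
      build inv = record
        { point     = List.lookup J
        ; dir       = λ p i → Line.dir (through p i)
        ; codir     = proj₁ ∘ inv
        ; lab       = proj₁ ∘ joint
        ; dual      = proj₂ ∘ inv
        ; collinear = λ p q i eq → onLine-difference (through p i) (on p i)
            (≡.subst (λ k → OnLine (List.lookup J q) (List.lookup (L i) k)) (≡.sym eq) (on q i))
        ; distinct  = AllPairs-lookup (λ x≉y y≈x → x≉y (λ i → sym (y≈x i))) distinct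
        }

  -- For every joint N Π a ≥ D ≥ n^d / d!, and for one of them N^d Π a ≤ Π m (n + 2N)^d. Together,
  -- after cancelling one N, they give an inequality for every positive n, and `compare-leading`
  -- extracts the leading coefficients.
  joints-inequality : ∀ {e N} {m : Fin (suc e) → ℕ} → Configuration (suc e) (suc N) m →
    suc N ^ e ≤ suc e ! * ∏ m
  joints-inequality {e} {N′} {m} J = compare-leading d (N ℕ.+ N) (N ^ e) (d ! * ∏ m) λ n′ → bound n′ (shares n′)
    where
    open Configuration J using (lab)
    open ℕ.≤-Reasoning
    d = suc e
    N = suc N′
    D : ℕ → ℕ
    D n′ = dimension d (suc n′)
    Shares : ℕ → Set
    Shares n′ = ∃ λ (a : Fin N → Fin d → ℕ) → (∀ p i → ℕ.NonZero (a p i)) × (∀ p → D n′ ≤ N * ∏ (a p)) ×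
      (∀ i → ∑ (λ p → a p i) ≤ m i * (suc n′ ℕ.+ (N ℕ.+ N)))
    shares : ∀ n′ → Shares n′
    shares n′ = fair-shares lab (suc n′) (D n′) (s≤s z≤n)
      (ℕ.>-nonZero⁻¹ (D n′) {{ℕ.m*n≢0⇒n≢0 (d !) {{ℕ.>-nonZero (ℕ.≤-trans (ℕ.m^n>0 (suc n′) d) (dimension-lower-bound d n′))}}}})
      (λ x level closed big K? Kne → Vanishing.dimension-bound J x level closed big K? Kne)
    bound : ∀ n′ → Shares n′ → suc n′ ^ d * N ^ e ≤ d ! * ∏ m * (suc n′ ℕ.+ (N ℕ.+ N)) ^ d
    bound n′ (a , a≢0 , D≤ , S≤) with p , hölder ← hölder-min a a≢0 = ℕ.*-cancelˡ-≤ N (begin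
      N * (n ^ d * N ^ e)                          ≡⟨ eq₁ N (n ^ d) (N ^ e) ⟩
      n ^ d * N ^ d                                ≤⟨ ℕ.*-monoˡ-≤ (N ^ d) (dimension-lower-bound d n′) ⟩
      d ! * D n′ * N ^ d                           ≤⟨ ℕ.*-monoˡ-≤ (N ^ d) (ℕ.*-monoʳ-≤ (d !) (D≤ p)) ⟩
      d ! * (N * ∏ (a p)) * N ^ d                  ≡⟨ eq₂ (d !) N (∏ (a p)) (N ^ d) ⟩
      N * d ! * (N ^ d * ∏ (a p))                  ≤⟨ ℕ.*-monoʳ-≤ (N * d !) hölder ⟩
      N * d ! * ∏ (λ i → ∑ (λ p → a p i))          ≤⟨ ℕ.*-monoʳ-≤ (N * d !) (∏-mono S≤) ⟩
      N * d ! * ∏ (λ i → m i * u)                  ≡⟨ ≡.cong (N * d ! *_) (≡.trans (∏-distrib-* m (λ _ → u)) (≡.cong (∏ m *_) (∏-const d u))) ⟩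
      N * d ! * (∏ m * u ^ d)                      ≡⟨ eq₃ N (d !) (∏ m) (u ^ d) ⟩
      N * (d ! * ∏ m * u ^ d)                      ∎)
      where
      n = suc n′
      u = n ℕ.+ (N ℕ.+ N)
      eq₁ : ∀ N A B → N * (A * B) ≡ A * (N * B)
      eq₁ = solve-∀
      eq₂ : ∀ f N P E → f * (N * P) * E ≡ N * f * (E * P)
      eq₂ = solve-∀
      eq₃ : ∀ N f P U → N * f * (P * U) ≡ N * (f * P * U)
      eq₃ = solve-∀

theorem3p3 : ∀ {c ℓ} (F : Field c ℓ) (d : ℕ) → 2 ≤ d →
    (L : Fin d → List (Geometry.Line F d)) →
    (∀ i → Geometry.DistinctLines F d (L i)) →
    (J : List (Geometry.Point F d)) →
    Geometry.DistinctPoints F d J →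
    All (Geometry.IsJoint F d L) J →
    length J ^ (d ∸ 1) ≤ (d !) * product (tabulate (λ i → length (L i)))
theorem3p3 F (suc (suc e)) (s≤s (s≤s _)) L _ []         _        _      = z≤n
theorem3p3 F (suc (suc e)) (s≤s (s≤s _)) L _ J@(x ∷ xs) distinct joints = decidable-stable (_ ℕ.≤? _)
  (¬¬-map (λ conf → ≡.subst (λ P → length J ^ suc e ≤ suc (suc e) ! * P)
                      (≡.sym (product-tabulate (length ∘ L))) (joints-inequality F conf))
    (configuration F (suc (suc e)) L J distinct joints))
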